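{- Let $(\mathbf{S},\mathcal{E})$ be a finite information structure. Let $\operatorname{Exp}=\{\operatorname{Exp}_X\}_{X\in \operatorname{Ob}\mathbf{S}}$ be the section of $\mathcal{G}$ defined by $$\operatorname{Exp}_X:\mathcal{C}_X\to\mathbb{R}_+^*,\qquad \nu\mapsto\exp(\|\nu\|).$$ Then $H^0(\mathbf{S},\mathcal{G})=\langle\operatorname{Exp}\rangle_{\mathbb{R}}$, the real vector space generated by $\operatorname{Exp}$.
   Context: $\mathbb{N}=\{0,1,2,\dots\}$ and $\mathbb{R}_+^*=\{x\in\mathbb{R}: x>0\}$. A finite information structure is a pair $(\mathbf{S},\mathcal{E})$. Here $\mathbf{S}$ is a small category that is a poset (at most one arrow between any two objects, and $A\to B$, $B\to A$ imply $A=B$), has a terminal object $\mathbf{1}$, and is such that whenever there is a diagram $X\leftarrow Z\to Y$ the categorical product $X\wedge Y$ exists (written also $XY$). $\mathcal{E}$ is a functor from $\mathbf{S}$ to finite sets and surjections, $X\mapsto E_X$, which does not send nonidentity arrows to isomorphisms, such that $E_{\mathbf{1}}$ is a singleton and, whenever $X\wedge Y$ exists, the map $E_{X\wedge Y}\to E_X\times E_Y$ induced by the two projections is injective. For an object $X$, $\mathcal{C}_X=\{\nu:E_X\to\mathbb{N} : \sum_{x\in E_X}\nu(x)>0\}$ (counting functions) and $\|\nu\|=\sum_{x}\nu(x)$. For an arrow $\pi:X\to Y$ and $\nu\in \mathcal{C}_X$, $Y_*\nu\in\mathcal{C}_Y$ is $Y_*\nu(y)=\sum_{x\in\mathcal{E}\pi^{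 -1}(y)}\nu(x)$. If $Y_*\nu(y)\neq 0$, $\nu|_{Y=y}\in\mathcal{C}_X$ equals $\nu$ on $\mathcal{E}\pi^{ -1}(y)$ and $0$ elsewhere. $\mathcal{G}_X$ is the multiplicative group of measurable functions $\mathcal{C}_X\to\mathbb{R}_+^*$; it is a real vector space via $(r.g)(\nu)=g(\nu)^r$. An arrow $X\to Y$ induces $\mathcal{G}_Y\to\mathcal{G}_X$, $g\mapsto (\nu\mapsto g(Y_*\nu))$. For $X\to Y$ and $g\in\mathcal{G}_X$, $(Y.g)(\nu)=\prod_{y\in E_Y,\,Y_*\nu(y)\neq0}g(\nu|_{Y=y})$. A combinatorial $0$-cochain is a family $\psi=\{\psi_X\in\mathcal{G}_X\}_{X\in\operatorname{Ob}\mathbf{S}}$ such that $\psi_X(\nu)=\psi_Y(Y_*\nu)$ for every arrow $X\to Y$ and $\nu\in\mathcal{C}_X$. Its coboundary is $(\delta\psi)_X[Y]=(Y.\psi_X)\,\psi_X^{ -1}$ for all $X$ and all $Y$ with $X\to Y$. $H^0(\mathbf{S},\mathcal{G})$ is the vector space of $0$-cocycles, i.e. $0$-cochains with $(\delta\psi)_X[Y]\equiv 1$ for all $X\to Y$; the vector space structure is pointwise multiplication and real powers, so $\langle\operatorname{Exp}\rangle_{\mathbb{R}}$ consists of the families $\{\nu\mapsto\exp(r\|\nu\|)\}_{X\in\operatorname{Ob}\mathbf{S}}$, $r\in\mathbb{R}$.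
   Formalization: The structure is assumed to have some object other than the terminal object 1; for the one-object structure every function from positive integers to positive reals is a 0-cocycle, so the claim fails there. -}

module Defs where

open import Level using (Level; _⊔_) renaming (suc to lsuc)
open import Algebra.Bundles using (Semiring; CommutativeRing; AbelianGroup)
open import Algebra.Structures using (IsAbelianGroup)
open import Data.Bool.Base using (if_then_else_)
open import Data.Fin.Base using (Fin; zero; suc)
import Data.Fin.Properties as Fin
open import Data.Nat.Base as ℕ using (ℕ; zero; suc)
import Data.Nat.Properties as ℕ
open import Data.Product using (Σ; Σ-syntax; ∃; _×_; _,_; proj₁; proj₂)
open import Data.Sum using (_⊎_; inj₁; inj₂)
open import Data.Unit using (⊤)
open import Function.Base using (_∘_; _on_)
open import Function.Bundles using (_↔_; Func; Inverse)
open import Function.Definitions using (Injective; Surjective; Bijective)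
open import Function.Properties.Inverse using (↔⇒↣)
open import Relation.Binary.Bundles using (Setoid)
open import Relation.Binary.Definitions
  using (Irrelevant; Maximum; Cotransitive; DecidableEquality)
open import Relation.Binary.PropositionalEquality
  using (_≡_; _≢_; _≗_; refl; sym; trans; cong; module ≡-Reasoning)
open import Relation.Binary.Structures
  using (IsPartialOrder; IsStrictPartialOrder; IsPreorder)
import Relation.Binary.Construct.On as On
open import Relation.Nullary using (¬_; Dec; yes; no; does; contradiction)
open import Relation.Nullary.Decidable using (via-injection)
open import Relation.Unary using (Pred)

private variable
  c ℓ₁ ℓ₂ o ℓa ℓe : Level

-- The library has no type of real numbers, so ℝ is given axiomatically,
-- as a Cauchy complete archimedean ordered field.  These axioms
-- determine ℝ up to isomorphism.  They are the constructive ones: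
-- trichotomy is replaced by the weaker cotransitivity and antisymmetry
-- of the negated order, so the classical ℝ satisfies them as well.

record OrderedField c ℓ₁ ℓ₂ : Set (lsuc (c ⊔ ℓ₁ ⊔ ℓ₂)) where
  infix 4 _<_ _⟶_

  field
    commutativeRing : CommutativeRing c ℓ₁

  open CommutativeRing commutativeRing public
    hiding (refl; sym; trans; zero)

  field
    _<_                    : Carrier → Carrier → Set ℓ₂
    <-isStrictPartialOrder : IsStrictPartialOrder _≈_ _<_
    <-cotransitive         : Cotransitive _<_
    <-antisym              : ∀ {x y} → ¬ (x < y) → ¬ (y < x) → x ≈ y
    0<1                    : 0# < 1#
    +-monoˡ-<              : ∀ z {x y} → x < y → x + z < y + z
    *-pos                  : ∀ {x y} → 0# < x → 0# < y → 0# < x * y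
    inverse                : ∀ {x} → 0# < x → ∃ λ y → 0# < y × x * y ≈ 1#

  open import Algebra.Definitions.RawSemiring (Semiring.rawSemiring semiring) public
    using (_^_) renaming (_×_ to _⋆_)

  ι : ℕ → Carrier
  ι n = n ⋆ 1#

  -- |u m - u n| < ε for all m, n ≥ N; exchanging m and n gives the
  -- other half of the absolute value.
  IsCauchy : (ℕ → Carrier) → Set _
  IsCauchy u = ∀ ε → 0# < ε → ∃ λ N →
    ∀ m n → N ℕ.≤ m → N ℕ.≤ n → u m < u n + ε

  _⟶_ : (ℕ → Carrier) → Carrier → Set _
  u ⟶ l = ∀ ε → 0# < ε → ∃ λ N →
    ∀ n → N ℕ.≤ n → (u n < l + ε) × (l < u n + ε)

record RealNumbers c ℓ₁ ℓ₂ : Set (lsuc (c ⊔ ℓ₁ ⊔ ℓ₂)) where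
  field
    orderedField : OrderedField c ℓ₁ ℓ₂

  open OrderedField orderedField public

  field
    archimedean : ∀ x → ∃ λ n → x < ι n
    complete    : ∀ u → IsCauchy u → ∃ λ l → u ⟶ l

module RealProperties (ℝ : RealNumbers c ℓ₁ ℓ₂) where
  open RealNumbers ℝ
  open CommutativeRing commutativeRing using ()
    renaming (refl to ≈-refl; sym to ≈-sym; trans to ≈-trans)
  open IsStrictPartialOrder <-isStrictPartialOrder using ()
    renaming (irrefl to <-irrefl; trans to <-trans; asym to <-asym
             ; <-resp-≈ to <-resp; <-respˡ-≈ to <-respˡ; <-respʳ-≈ to <-respʳ)
  open import Algebra.Properties.Semiring.Mult semiring using (×-homo-+)
  open import Algebra.Properties.Ring ring using (-‿distribˡ-*; -‿distribʳ-*)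
  open import Algebra.Properties.Group +-group
    using (⁻¹-involutive) renaming (∙-cancelʳ to +-group-cancelʳ)
  open import Algebra.Solver.Ring.NaturalCoefficients.Default
    commutativeSemiring using (solve; con; _:+_; _:*_; _:=_)

  infix 4 _≤_
  _≤_ : Carrier → Carrier → Set ℓ₂
  x ≤ y = ¬ (y < x)

  <⇒≤ : ∀ {x y} → x < y → x ≤ y
  <⇒≤ = <-asym

  <-≤-trans : ∀ {x y z} → x < y → y ≤ z → x < z
  <-≤-trans {z = z} x<y y≤z with <-cotransitive x<y z
  ... | inj₁ x<z = x<z
  ... | inj₂ z<y = contradiction z<y y≤z

  ≤-<-trans : ∀ {x y z} → x ≤ y → y < z → x < z
  ≤-<-trans {x = x} x≤y y<z with <-cotransitive y<z x
  ... | inj₁ y<x = contradiction y<x x≤y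
  ... | inj₂ x<z = x<z

  ≤-trans : ∀ {x y z} → x ≤ y → y ≤ z → x ≤ z
  ≤-trans {y = y} x≤y y≤z z<x with <-cotransitive z<x y
  ... | inj₁ z<y = y≤z z<y
  ... | inj₂ y<x = x≤y y<x

  ≈⇒≤ : ∀ {x y} → x ≈ y → x ≤ y
  ≈⇒≤ x≈y = <-irrefl (≈-sym x≈y)

  ≤-isPreorder : IsPreorder _≈_ _≤_
  ≤-isPreorder = record
    { isEquivalence = isEquivalence
    ; reflexive     = ≈⇒≤
    ; trans         = ≤-trans
    }

  module ≤-Reasoning where
    open import Relation.Binary.Reasoning.Base.Triple
      ≤-isPreorder <-asym <-trans <-resp <⇒≤ <-≤-trans ≤-<-trans
      public

  open ≤-Reasoning

  +-cancelʳ : ∀ {x y z} → x + z ≈ y + z → x ≈ y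
  +-cancelʳ {x} {y} {z} = +-group-cancelʳ z x y

  cancel+ : ∀ x z → (x + z) + - z ≈ x
  cancel+ x z = ≈-trans (+-assoc x z (- z))
    (≈-trans (+-congˡ (-‿inverseʳ z)) (+-identityʳ x))

  cancel- : ∀ x z → (x + - z) + z ≈ x
  cancel- x z = ≈-trans (+-assoc x (- z) z)
    (≈-trans (+-congˡ (-‿inverseˡ z)) (+-identityʳ x))

  +-cancelʳ-< : ∀ {x y} z → x + z < y + z → x < y
  +-cancelʳ-< {x} {y} z p =
    <-respˡ (cancel+ x z) (<-respʳ (cancel+ y z) (+-monoˡ-< (- z) p))

  +-monoʳ-< : ∀ z {x y} → x < y → z + x < z + y
  +-monoʳ-< z p = <-respˡ (+-comm _ z) (<-respʳ (+-comm _ z) (+-monoˡ-< z p))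

  +-monoˡ-≤ : ∀ z {x y} → x ≤ y → x + z ≤ y + z
  +-monoˡ-≤ z x≤y p = x≤y (+-cancelʳ-< z p)

  +-monoʳ-≤ : ∀ z {x y} → x ≤ y → z + x ≤ z + y
  +-monoʳ-≤ z {x} {y} x≤y = begin
    z + x ≈⟨ +-comm z x ⟩
    x + z ≤⟨ +-monoˡ-≤ z x≤y ⟩
    y + z ≈⟨ +-comm y z ⟩
    z + y ∎

  x≤x+y : ∀ {x y} → 0# ≤ y → x ≤ x + y
  x≤x+y {x} {y} 0≤y = begin
    x      ≈⟨ +-identityʳ x ⟨
    x + 0# ≤⟨ +-monoʳ-≤ x 0≤y ⟩
    x + y  ∎

  x<x+y : ∀ {x y} → 0# < y → x < x + y
  x<x+y {x} {y} 0<y = begin-strict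
    x      ≈⟨ +-identityʳ x ⟨
    x + 0# <⟨ +-monoʳ-< x 0<y ⟩
    x + y  ∎

  <⇒0<- : ∀ {x y} → x < y → 0# < y + - x
  <⇒0<- {x} {y} x<y = <-respˡ (-‿inverseʳ x) (+-monoˡ-< (- x) x<y)

  *-monoˡ-< : ∀ {x y z} → 0# < z → x < y → z * x < z * y
  *-monoˡ-< {x} {y} {z} 0<z x<y = begin-strict
    z * x                     <⟨ x<x+y (*-pos 0<z (<⇒0<- x<y)) ⟩
    z * x + z * (y + - x)     ≈⟨ distribˡ z x (y + - x) ⟨
    z * (x + (y + - x))       ≈⟨ *-congˡ (+-comm x (y + - x)) ⟩
    z * ((y + - x) + x)       ≈⟨ *-congˡ (cancel- y x) ⟩
    z * y                     ∎

  *-monoˡ-≤ : ∀ {x y z} → 0# ≤ z → x ≤ y → z * x ≤ z * y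
  *-monoˡ-≤ {x} {y} {z} 0≤z x≤y zy<zx = <-irrefl zy≈zx zy<zx
    where
    ¬0<z : ¬ (0# < z)
    ¬0<z 0<z = <-irrefl (*-congˡ (<-antisym x≤y ¬x<y)) zy<zx
      where
      ¬x<y : ¬ (x < y)
      ¬x<y x<y = <-asym zy<zx (*-monoˡ-< 0<z x<y)
    z≈0 : z ≈ 0#
    z≈0 = <-antisym 0≤z ¬0<z
    zy≈zx : z * y ≈ z * x
    zy≈zx = begin-equality
      z * y  ≈⟨ *-congʳ z≈0 ⟩
      0# * y ≈⟨ zeroˡ y ⟩
      0#     ≈⟨ zeroˡ x ⟨
      0# * x ≈⟨ *-congʳ z≈0 ⟨
      z * x  ∎

  *-monoʳ-≤ : ∀ {x y z} → 0# ≤ z → x ≤ y → x * z ≤ y * z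
  *-monoʳ-≤ {x} {y} {z} 0≤z x≤y = begin
    x * z ≈⟨ *-comm x z ⟩
    z * x ≤⟨ *-monoˡ-≤ 0≤z x≤y ⟩
    z * y ≈⟨ *-comm z y ⟩
    y * z ∎

  0≤* : ∀ {x y} → 0# ≤ x → 0# ≤ y → 0# ≤ x * y
  0≤* {x} {y} 0≤x 0≤y = begin
    0#     ≈⟨ zeroʳ x ⟨
    x * 0# ≤⟨ *-monoˡ-≤ 0≤x 0≤y ⟩
    x * y  ∎

  *-cancelʳ-< : ∀ {x y z} → 0# < z → x * z < y * z → x < y
  *-cancelʳ-< {x} {y} {z} 0<z xz<yz with z⁻¹ , 0<z⁻¹ , zz⁻¹≈1 ← inverse 0<z =
    <-respˡ (drop x) (<-respʳ (drop y) (*-monoˡ-< 0<z⁻¹ xz<yz))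
    where
    drop : ∀ w → z⁻¹ * (w * z) ≈ w
    drop w = begin-equality
      z⁻¹ * (w * z) ≈⟨ solve 3 (λ i w z → i :* (w :* z) := w :* (z :* i)) ≈-refl z⁻¹ w z ⟩
      w * (z * z⁻¹) ≈⟨ *-congˡ zz⁻¹≈1 ⟩
      w * 1#        ≈⟨ *-identityʳ w ⟩
      w             ∎

  neg-pos : ∀ {x} → x < 0# → 0# < - x
  neg-pos {x} x<0 = <-respʳ (+-identityˡ (- x)) (<⇒0<- x<0)

  neg*neg : ∀ x → - x * - x ≈ x * x
  neg*neg x = begin-equality
    - x * - x     ≈⟨ -‿distribˡ-* x (- x) ⟨
    - (x * - x)   ≈⟨ -‿cong (-‿distribʳ-* x x) ⟨
    - (- (x * x)) ≈⟨ ⁻¹-involutive (x * x) ⟩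
    x * x         ∎

  0≤x² : ∀ x → 0# ≤ x * x
  0≤x² x x²<0 = <-irrefl x²≈0 x²<0
    where
    ¬0<x : ¬ (0# < x)
    ¬0<x 0<x = <-asym x²<0 (*-pos 0<x 0<x)
    ¬x<0 : ¬ (x < 0#)
    ¬x<0 x<0 = <-asym x²<0
      (<-respʳ (neg*neg x) (*-pos (neg-pos x<0) (neg-pos x<0)))
    x²≈0 : x * x ≈ 0#
    x²≈0 = ≈-trans (*-congˡ (<-antisym ¬x<0 ¬0<x)) (zeroʳ x)

  ^-nonneg : ∀ {x} n → 0# ≤ x → 0# ≤ x ^ n
  ^-nonneg zero    0≤x = <⇒≤ 0<1
  ^-nonneg (suc n) 0≤x = 0≤* 0≤x (^-nonneg n 0≤x)

  ^-pos : ∀ {x} n → 0# < x → 0# < x ^ n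
  ^-pos zero    0<x = 0<1
  ^-pos (suc n) 0<x = *-pos 0<x (^-pos n 0<x)

  ^≤1 : ∀ {x} n → 0# ≤ x → x ≤ 1# → x ^ n ≤ 1#
  ^≤1 zero    0≤x x≤1 = ≈⇒≤ ≈-refl
  ^≤1 {x} (suc n) 0≤x x≤1 = begin
    x * x ^ n ≤⟨ *-monoˡ-≤ 0≤x (^≤1 n 0≤x x≤1) ⟩
    x * 1#    ≈⟨ *-identityʳ x ⟩
    x         ≤⟨ x≤1 ⟩
    1#        ∎

  ι-nonneg : ∀ n → 0# ≤ ι n
  ι-nonneg zero    = ≈⇒≤ ≈-refl
  ι-nonneg (suc n) = begin
    0#       ≤⟨ <⇒≤ 0<1 ⟩
    1#       ≤⟨ x≤x+y (ι-nonneg n) ⟩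
    1# + ι n ∎

  abstract
    ι-pos : ∀ n → 0# < ι (suc n)
    ι-pos n = <-≤-trans 0<1 (x≤x+y (ι-nonneg n))

  ι-mono : ∀ {m n} → m ℕ.≤ n → ι m ≤ ι n
  ι-mono {m} {n} m≤n = begin
    ι m               ≤⟨ x≤x+y (ι-nonneg (n ℕ.∸ m)) ⟩
    ι m + ι (n ℕ.∸ m) ≈⟨ ×-homo-+ 1# m (n ℕ.∸ m) ⟨
    ι (m ℕ.+ (n ℕ.∸ m)) ≡⟨ cong ι (ℕ.m+[n∸m]≡n m≤n) ⟩
    ι n               ∎

  -- The tangent to t ↦ t^(n+1) at b lies below its graph.
  tangent : ∀ {b d} n → 0# ≤ b → 0# ≤ b + d →
            b ^ n * (b + ι (suc n) * d) ≤ (b + d) ^ suc n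
  tangent {b} {d} zero 0≤b 0≤b+d = ≈⇒≤
    (solve 2 (λ b d → con 1 :* (b :+ (con 1 :+ con 0) :* d) := (b :+ d) :* con 1)
       ≈-refl b d)
  tangent {b} {d} (suc n) 0≤b 0≤b+d = begin
    (b * b ^ n) * (b + (1# + k) * d)
      ≤⟨ x≤x+y (0≤* (^-nonneg n 0≤b) (0≤* (ι-nonneg (suc n)) (0≤x² d))) ⟩
    (b * b ^ n) * (b + (1# + k) * d) + b ^ n * (k * (d * d))
      ≈⟨ solve 4 (λ b d p k → (b :* p) :* (b :+ (con 1 :+ k) :* d) :+ p :* (k :* (d :* d))
                   := (b :+ d) :* (p :* (b :+ k :* d)))
           ≈-refl b d (b ^ n) k ⟩
    (b + d) * (b ^ n * (b + k * d))
      ≤⟨ *-monoˡ-≤ 0≤b+d (tangent n 0≤b 0≤b+d) ⟩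
    (b + d) * (b + d) ^ suc n ∎
    where k = ι (suc n)

  1^ : ∀ n → 1# ^ n ≈ 1#
  1^ zero    = ≈-refl
  1^ (suc n) = ≈-trans (*-identityˡ _) (1^ n)

  bernoulli : ∀ {d} n → 0# ≤ 1# + d → 1# + ι (suc n) * d ≤ (1# + d) ^ suc n
  bernoulli {d} n 0≤1+d = begin
    1# + ι (suc n) * d            ≈⟨ *-identityˡ _ ⟨
    1# * (1# + ι (suc n) * d)     ≈⟨ *-congʳ (1^ n) ⟨
    1# ^ n * (1# + ι (suc n) * d) ≤⟨ tangent n (<⇒≤ 0<1) 0≤1+d ⟩
    (1# + d) ^ suc n              ∎

  limit-≥ : ∀ {u l b N} → (∀ n → N ℕ.≤ n → b ≤ u n) → u ⟶ l → b ≤ l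
  limit-≥ {u} {l} {b} {N} b≤u u⟶l l<b
    with K , close ← u⟶l (b + - l) (<⇒0<- l<b) =
    <-irrefl ≈-refl (begin-strict
      b             ≤⟨ b≤u n (ℕ.m≤m⊔n N K) ⟩
      u n           <⟨ proj₁ (close n (ℕ.m≤n⊔m N K)) ⟩
      l + (b + - l) ≈⟨ +-comm l (b + - l) ⟩
      (b + - l) + l ≈⟨ cancel- b l ⟩
      b             ∎)
    where n = N ℕ.⊔ K

module PositiveReals (ℝ : RealNumbers c ℓ₁ ℓ₂) where
  open RealNumbers ℝ
  open CommutativeRing commutativeRing using ()
    renaming (refl to ≈-refl; sym to ≈-sym; trans to ≈-trans)
  open IsStrictPartialOrder <-isStrictPartialOrder using ()
    renaming (irrefl to <-irrefl; <-respʳ-≈ to <-respʳ)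
  open import Algebra.Properties.Semiring.Exp semiring using (^-congˡ)
  open import Algebra.Properties.CommutativeSemiring.Exp commutativeSemiring
    using (^-distrib-*)
  open import Algebra.Properties.Ring ring using (-‿distribˡ-*; -‿distribʳ-*)
  open RealProperties ℝ
  open ≤-Reasoning
  open import Algebra.Solver.Ring.NaturalCoefficients.Default
    commutativeSemiring using (solve; con; _:+_; _:*_; _:=_)

  1/1+ : ℕ → Carrier
  1/1+ k = proj₁ (inverse (ι-pos k))

  1/1+-pos : ∀ k → 0# < 1/1+ k
  1/1+-pos k = proj₁ (proj₂ (inverse (ι-pos k)))

  1/1+-inverse : ∀ k → ι (suc k) * 1/1+ k ≈ 1#
  1/1+-inverse k = proj₂ (proj₂ (inverse (ι-pos k)))

  -- (1 + x / n)ⁿ for n = suc k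
  expSeq : Carrier → ℕ → Carrier
  expSeq x k = (1# + x * 1/1+ k) ^ suc k

  record Large (x : Carrier) (k : ℕ) : Set ℓ₂ where
    constructor is-large
    field 0<n+x : 0# < ι (suc k) + x

  large-mono : ∀ {x j k} → j ℕ.≤ k → Large x j → Large x k
  large-mono {x} j≤k (is-large p) =
    is-large (<-≤-trans p (+-monoˡ-≤ x (ι-mono (ℕ.s≤s j≤k))))

  large : ∀ x → ∃ (Large x)
  large x with N , -x<N ← archimedean (- x) = N , is-large (begin-strict
    0#           ≈⟨ -‿inverseˡ x ⟨
    - x + x      <⟨ +-monoˡ-< x -x<N ⟩
    ι N + x      ≤⟨ +-monoˡ-≤ x (ι-mono (ℕ.n≤1+n N)) ⟩
    ι (suc N) + x ∎)

  scale : ∀ x k → ι (suc k) * (1# + x * 1/1+ k) ≈ ι (suc k) + x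
  scale x k = begin-equality
    n * (1# + x * i) ≈⟨ solve 3 (λ n x i → n :* (con 1 :+ x :* i) := n :+ x :* (n :* i)) ≈-refl n x i ⟩
    n + x * (n * i)  ≈⟨ +-congˡ (*-congˡ (1/1+-inverse k)) ⟩
    n + x * 1#       ≈⟨ +-congˡ (*-identityʳ x) ⟩
    n + x            ∎
    where n = ι (suc k); i = 1/1+ k

  base-pos : ∀ {x k} → Large x k → 0# < 1# + x * 1/1+ k
  base-pos {x} {k} (is-large p) = *-cancelʳ-< (ι-pos k) (begin-strict
    0# * ι (suc k)                ≈⟨ zeroˡ _ ⟩
    0#                            <⟨ p ⟩
    ι (suc k) + x                 ≈⟨ scale x k ⟨
    ι (suc k) * (1# + x * 1/1+ k) ≈⟨ *-comm _ _ ⟩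
    (1# + x * 1/1+ k) * ι (suc k) ∎)

  expSeq-pos : ∀ {x k} → Large x k → 0# < expSeq x k
  expSeq-pos {k = k} p = ^-pos (suc k) (base-pos p)

  expSeq-step : ∀ {x k} → Large x k → expSeq x k ≤ expSeq x (suc k)
  expSeq-step {x} {k} p = begin
    b ^ suc k                     ≈⟨ *-identityʳ _ ⟨
    b ^ suc k * 1#                ≈⟨ *-congˡ slope ⟨
    b ^ suc k * (b + m * d)       ≤⟨ tangent (suc k) (<⇒≤ (base-pos p)) 0≤b+d ⟩
    (b + d) ^ suc (suc k)         ≈⟨ ^-congˡ (suc (suc k)) b+d≈a ⟩
    a ^ suc (suc k)               ∎
    where
    n = ι (suc k)
    m = ι (suc (suc k))
    b = 1# + x * 1/1+ k
    a = 1# + x * 1/1+ (suc k)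
    d = a + - b
    b+d≈a : b + d ≈ a
    b+d≈a = ≈-trans (+-comm b d) (cancel- a b)
    0≤b+d : 0# ≤ b + d
    0≤b+d = ≤-trans (<⇒≤ (base-pos (large-mono (ℕ.n≤1+n k) p)))
                    (≈⇒≤ (≈-sym b+d≈a))
    slope : b + m * d ≈ 1#
    slope = +-cancelʳ (begin-equality
      (b + (1# + n) * d) + n * b ≈⟨ solve 3 (λ b n d →
          (b :+ (con 1 :+ n) :* d) :+ n :* b := (con 1 :+ n) :* (b :+ d)) ≈-refl b n d ⟩
      m * (b + d)                ≈⟨ *-congˡ b+d≈a ⟩
      m * a                      ≈⟨ scale x (suc k) ⟩
      (1# + n) + x               ≈⟨ +-assoc 1# n x ⟩
      1# + (n + x)               ≈⟨ +-congˡ (scale x k) ⟨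
      1# + n * b                 ∎)

  expSeq-mono : ∀ {x j k} → Large x j → j ℕ.≤ k → expSeq x j ≤ expSeq x k
  expSeq-mono {x} {j} p j≤k = go (ℕ.≤⇒≤′ j≤k)
    where
    go : ∀ {k} → j ℕ.≤′ k → expSeq x j ≤ expSeq x k
    go (ℕ.≤′-reflexive refl) = ≈⇒≤ ≈-refl
    go (ℕ.≤′-step q) =
      ≤-trans (go q) (expSeq-step (large-mono (ℕ.≤′⇒≤ q) p))

  module Opposite {x k} (p : Large x k) (q : Large (- x) k) where
    private
      n = ι (suc k)
      i = 1/1+ k
      y = x * i
      d = y * (- x * i)

      d≈-y² : d ≈ - (y * y)
      d≈-y² = begin-equality
        y * (- x * i)   ≈⟨ *-congˡ (-‿distribˡ-* x i) ⟨
        y * - y         ≈⟨ -‿distribʳ-* y y ⟨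
        - (y * y)       ∎

      base-product : (1# + y) * (1# + - x * i) ≈ 1# + d
      base-product = begin-equality
        (1# + y) * (1# + - x * i)
          ≈⟨ solve 3 (λ x x′ i → (con 1 :+ x :* i) :* (con 1 :+ x′ :* i)
               := (con 1 :+ (x :* i) :* (x′ :* i)) :+ (x :+ x′) :* i) ≈-refl x (- x) i ⟩
        (1# + d) + (x + - x) * i ≈⟨ +-congˡ (*-congʳ (-‿inverseʳ x)) ⟩
        (1# + d) + 0# * i        ≈⟨ +-congˡ (zeroˡ i) ⟩
        (1# + d) + 0#            ≈⟨ +-identityʳ _ ⟩
        1# + d                   ∎

      product : expSeq x k * expSeq (- x) k ≈ (1# + d) ^ suc k
      product = begin-equality
        expSeq x k * expSeq (- x) k             ≈⟨ ^-distrib-* _ _ (suc k) ⟨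
        ((1# + y) * (1# + - x * i)) ^ suc k     ≈⟨ ^-congˡ (suc k) base-product ⟩
        (1# + d) ^ suc k                        ∎

      0≤1+d : 0# ≤ 1# + d
      0≤1+d = <⇒≤ (<-respʳ base-product (*-pos (base-pos p) (base-pos q)))

      1+d≤1 : 1# + d ≤ 1#
      1+d≤1 = begin
        1# + d                     ≤⟨ x≤x+y (0≤x² y) ⟩
        (1# + d) + y * y           ≈⟨ +-congʳ (+-congˡ d≈-y²) ⟩
        (1# + - (y * y)) + y * y   ≈⟨ cancel- 1# (y * y) ⟩
        1#                         ∎

    product≤1 : expSeq x k * expSeq (- x) k ≤ 1#
    product≤1 = ≤-trans (≈⇒≤ product) (^≤1 (suc k) 0≤1+d 1+d≤1)

    1≤product+ : 1# ≤ expSeq x k * expSeq (- x) k + (x * x) * i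
    1≤product+ = begin
      1#                                ≈⟨ +-identityʳ 1# ⟨
      1# + 0#                           ≈⟨ +-congˡ nd≈ ⟨
      1# + (n * d + (x * x) * i)        ≈⟨ +-assoc 1# _ _ ⟨
      (1# + n * d) + (x * x) * i        ≤⟨ +-monoˡ-≤ _ (bernoulli k 0≤1+d) ⟩
      (1# + d) ^ suc k + (x * x) * i    ≈⟨ +-congʳ product ⟨
      expSeq x k * expSeq (- x) k + (x * x) * i ∎
      where
      nd≈ : n * d + (x * x) * i ≈ 0#
      nd≈ = begin-equality
        n * d + (x * x) * i
          ≈⟨ solve 4 (λ n x x′ i → n :* ((x :* i) :* (x′ :* i)) :+ (x :* x) :* i
               := ((n :* i) :* x′ :+ x) :* (x :* i)) ≈-refl n x (- x) i ⟩
        ((n * i) * - x + x) * (x * i) ≈⟨ *-congʳ (+-congʳ (*-congʳ (1/1+-inverse k))) ⟩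
        (1# * - x + x) * (x * i)      ≈⟨ *-congʳ (+-congʳ (*-identityˡ (- x))) ⟩
        (- x + x) * (x * i)           ≈⟨ *-congʳ (-‿inverseˡ x) ⟩
        0# * (x * i)                  ≈⟨ zeroˡ _ ⟩
        0#                            ∎

  remainder-small : ∀ x {δ w M k} → 0# < w → δ * w ≈ 1# →
                    (x * x) * w < ι M → M ℕ.≤ k → (x * x) * 1/1+ k < δ
  remainder-small x {δ} {w} {M} {k} 0<w δw≈1 x²w<M M≤k =
    *-cancelʳ-< (*-pos (ι-pos k) 0<w) (begin-strict
      ((x * x) * i) * (n * w)
        ≈⟨ solve 4 (λ x i n w → ((x :* x) :* i) :* (n :* w)
             := (n :* i) :* ((x :* x) :* w)) ≈-refl x i n w ⟩
      (n * i) * ((x * x) * w) ≈⟨ *-congʳ (1/1+-inverse k) ⟩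
      1# * ((x * x) * w)      ≈⟨ *-identityˡ _ ⟩
      (x * x) * w             <⟨ x²w<M ⟩
      ι M                     ≤⟨ ι-mono (ℕ.≤-trans M≤k (ℕ.n≤1+n k)) ⟩
      n                       ≈⟨ *-identityʳ n ⟨
      n * 1#                  ≈⟨ *-congˡ δw≈1 ⟨
      n * (δ * w)             ≈⟨ *-assoc n δ w ⟨
      (n * δ) * w             ≈⟨ *-congʳ (*-comm n δ) ⟩
      (δ * n) * w             ≈⟨ *-assoc δ n w ⟩
      δ * (n * w)             ∎)
    where
    n = ι (suc k)
    i = 1/1+ k

  expSeq-close : ∀ {x N ε i j} → Large x N → Large (- x) N → 0# < ε →
                 N ℕ.≤ i → N ℕ.≤ j →
                 (x * x) * 1/1+ j < ε * expSeq (- x) N →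
                 expSeq x i < expSeq x j + ε
  expSeq-close {x} {N} {ε} {i} {j} p q 0<ε N≤i N≤j small = go (ℕ.≤-total i j)
    where
    e′ = expSeq (- x) j
    0<e′ : 0# < e′
    0<e′ = expSeq-pos (large-mono N≤j q)
    go : i ℕ.≤ j ⊎ j ℕ.≤ i → expSeq x i < expSeq x j + ε
    go (inj₁ i≤j) =
      ≤-<-trans (expSeq-mono (large-mono N≤i p) i≤j) (x<x+y 0<ε)
    go (inj₂ j≤i) = *-cancelʳ-< 0<e′ (begin-strict
      expSeq x i * e′
        ≤⟨ *-monoˡ-≤ (<⇒≤ (expSeq-pos (large-mono N≤i p)))
             (expSeq-mono (large-mono N≤j q) j≤i) ⟩
      expSeq x i * expSeq (- x) i
        ≤⟨ Opposite.product≤1 (large-mono N≤i p) (large-mono N≤i q) ⟩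
      1#
        ≤⟨ Opposite.1≤product+ (large-mono N≤j p) (large-mono N≤j q) ⟩
      expSeq x j * e′ + (x * x) * 1/1+ j
        <⟨ +-monoʳ-< _ small ⟩
      expSeq x j * e′ + ε * expSeq (- x) N
        ≤⟨ +-monoʳ-≤ _ (*-monoˡ-≤ (<⇒≤ 0<ε) (expSeq-mono q N≤j)) ⟩
      expSeq x j * e′ + ε * e′
        ≈⟨ distribʳ e′ (expSeq x j) ε ⟨
      (expSeq x j + ε) * e′ ∎)

  expSeq-cauchy-from : ∀ {x N} → Large x N → Large (- x) N → IsCauchy (expSeq x)
  expSeq-cauchy-from {x} {N} p q ε 0<ε = go (inverse (*-pos 0<ε (expSeq-pos q)))
    where
    δ = ε * expSeq (- x) N
    go : (∃ λ w → 0# < w × δ * w ≈ 1#) →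
         ∃ λ K → ∀ i j → K ℕ.≤ i → K ℕ.≤ j → expSeq x i < expSeq x j + ε
    go (w , 0<w , δw≈1) = N ℕ.⊔ M , λ i j K≤i K≤j →
      expSeq-close p q 0<ε
        (ℕ.≤-trans (ℕ.m≤m⊔n N M) K≤i) (ℕ.≤-trans (ℕ.m≤m⊔n N M) K≤j)
        (remainder-small x 0<w δw≈1 (proj₂ (archimedean ((x * x) * w)))
          (ℕ.≤-trans (ℕ.m≤n⊔m N M) K≤j))
      where M = proj₁ (archimedean ((x * x) * w))

  abstract
    expSeq-cauchy : ∀ x → IsCauchy (expSeq x)
    expSeq-cauchy x = go (large x) (large (- x))
      where
      go : ∃ (Large x) → ∃ (Large (- x)) → IsCauchy (expSeq x)
      go (N₁ , p) (N₂ , q) = expSeq-cauchy-from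
        (large-mono (ℕ.m≤m⊔n N₁ N₂) p) (large-mono (ℕ.m≤n⊔m N₁ N₂) q)

  expLimit : ∀ x → ∃ λ l → expSeq x ⟶ l
  expLimit x = complete (expSeq x) (expSeq-cauchy x)

  abstract
    expLimit-pos : ∀ x → 0# < proj₁ (expLimit x)
    expLimit-pos x = go (large x)
      where
      go : ∃ (Large x) → 0# < proj₁ (expLimit x)
      go (N , p) = <-≤-trans (expSeq-pos p)
        (limit-≥ (λ n N≤n → expSeq-mono p N≤n) (proj₂ (expLimit x)))

  ℝ₊ : Set (c ⊔ ℓ₂)
  ℝ₊ = Σ[ x ∈ Carrier ] 0# < x

  infix 4 _≈₊_
  _≈₊_ : ℝ₊ → ℝ₊ → Set ℓ₁
  _≈₊_ = _≈_ on proj₁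

  -- exp x = lim (1 + x / n)ⁿ
  exp : Carrier → ℝ₊
  exp x = proj₁ (expLimit x) , expLimit-pos x

  exp-limit : ∀ x → expSeq x ⟶ proj₁ (exp x)
  exp-limit x = proj₂ (expLimit x)

  _·_ : ℝ₊ → ℝ₊ → ℝ₊
  (x , 0<x) · (y , 0<y) = x * y , *-pos 0<x 0<y

  1₊ : ℝ₊
  1₊ = 1# , 0<1

  recip : ℝ₊ → ℝ₊
  recip (x , 0<x) = proj₁ (inverse 0<x) , proj₁ (proj₂ (inverse 0<x))

  recip-inverseʳ : ∀ x → (x · recip x) ≈₊ 1₊
  recip-inverseʳ (x , 0<x) = proj₂ (proj₂ (inverse 0<x))

  recip-cong : ∀ {x y} → x ≈₊ y → recip x ≈₊ recip y
  recip-cong {x} {y} x≈y = begin-equality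
    x′                         ≈⟨ *-identityʳ x′ ⟨
    x′ * 1#                    ≈⟨ *-congˡ (recip-inverseʳ y) ⟨
    x′ * (proj₁ y * y′)        ≈⟨ *-congˡ (*-congʳ x≈y) ⟨
    x′ * (proj₁ x * y′)        ≈⟨ solve 3 (λ a b c → a :* (b :* c) := (b :* a) :* c) ≈-refl x′ (proj₁ x) y′ ⟩
    (proj₁ x * x′) * y′        ≈⟨ *-congʳ (recip-inverseʳ x) ⟩
    1# * y′                    ≈⟨ *-identityˡ y′ ⟩
    y′                         ∎
    where
    x′ = proj₁ (recip x)
    y′ = proj₁ (recip y)

  ℝ₊-isAbelianGroup : IsAbelianGroup _≈₊_ _·_ 1₊ recip
  ℝ₊-isAbelianGroup = record
    { isGroup = record
      { isMonoid = record
        { isSemigroup = record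
          { isMagma = record
            { isEquivalence = On.isEquivalence proj₁ isEquivalence
            ; ∙-cong        = *-cong
            }
          ; assoc = λ x y z → *-assoc (proj₁ x) (proj₁ y) (proj₁ z)
          }
        ; identity = (λ x → *-identityˡ (proj₁ x)) , (λ x → *-identityʳ (proj₁ x))
        }
      ; inverse = (λ x → ≈-trans (*-comm _ _) (recip-inverseʳ x)) , recip-inverseʳ
      ; ⁻¹-cong = λ {x} {y} → recip-cong {x} {y}
      }
    ; comm = λ x y → *-comm (proj₁ x) (proj₁ y)
    }

  ℝ₊-abelianGroup : AbelianGroup (c ⊔ ℓ₂) ℓ₁
  ℝ₊-abelianGroup = record { isAbelianGroup = ℝ₊-isAbelianGroup }

-- X ⇒ Y is the type of arrows X → Y.
record PosetCategory o ℓa : Set (lsuc (o ⊔ ℓa)) where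
  infix 4 _⇒_

  field
    Ob               : Set o
    _⇒_              : Ob → Ob → Set ℓa
    ⇒-isPartialOrder : IsPartialOrder _≡_ _⇒_
    ⇒-irrelevant     : Irrelevant _⇒_

  open IsPartialOrder ⇒-isPartialOrder public
    using () renaming (refl to idA; trans to infixl 9 _⨟_)

  -- As there is at most one arrow between two objects, the mediating
  -- arrow is unique and its triangles commute.
  record IsProduct (X Y W : Ob) : Set (o ⊔ ℓa) where
    field
      π₁       : W ⇒ X
      π₂       : W ⇒ Y
      mediator : ∀ {Z} → Z ⇒ X → Z ⇒ Y → Z ⇒ W

record InformationStructure o ℓa ℓe : Set (lsuc (o ⊔ ℓa ⊔ ℓe)) where
  field
    category : PosetCategory o ℓa

  open PosetCategory category public

  field
    𝟏              : Ob
    𝟏-terminal     : Maximum _⇒_ 𝟏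
    product-exists : ∀ {X Y Z} → Z ⇒ X → Z ⇒ Y → ∃ (IsProduct X Y)

    E              : Ob → Set ℓe
    E-finite       : ∀ X → ∃ λ n → E X ↔ Fin n
    ℰ              : ∀ {X Y} → X ⇒ Y → E X → E Y
    ℰ-id           : ∀ {X} (x : E X) → ℰ idA x ≡ x
    ℰ-∘            : ∀ {X Y Z} (π : X ⇒ Y) (ρ : Y ⇒ Z) (x : E X) →
                     ℰ (π ⨟ ρ) x ≡ ℰ ρ (ℰ π x)
    ℰ-surjective   : ∀ {X Y} (π : X ⇒ Y) → Surjective _≡_ _≡_ (ℰ π)
    -- An arrow X ⇒ Y is an identity exactly when X ≡ Y.
    ℰ-conservative : ∀ {X Y} (π : X ⇒ Y) → X ≢ Y →
                     ¬ Bijective _≡_ _≡_ (ℰ π)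
    E𝟏-singleton   : E 𝟏 ↔ ⊤
    ℰ-product-injective : ∀ {X Y W} (P : IsProduct X Y W) →
      Injective _≡_ _≡_
        (λ w → ℰ (IsProduct.π₁ P) w , ℰ (IsProduct.π₂ P) w)

  -- Excludes the one-object structure, on which every 0-cochain is a
  -- cocycle: there Y_*ν = ν for the only arrow, and E 𝟏 is a singleton.
  Nontrivial : Set o
  Nontrivial = ∃ λ X → X ≢ 𝟏

module Counting (𝐒 : InformationStructure o ℓa ℓe) where
  open InformationStructure 𝐒
  open import Algebra.Properties.CommutativeMonoid.Sum ℕ.+-0-commutativeMonoid
    using (sum; sum-cong-≗; ∑-comm; sum-replicate-zero)
  open ≡-Reasoning

  ∣E_∣ : Ob → ℕ
  ∣E X ∣ = proj₁ (E-finite X)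

  enum : ∀ X → Fin ∣E X ∣ → E X
  enum X = Inverse.from (proj₂ (E-finite X))

  index : ∀ X → E X → Fin ∣E X ∣
  index X = Inverse.to (proj₂ (E-finite X))

  index-enum : ∀ X i → index X (enum X i) ≡ i
  index-enum X i = Inverse.strictlyInverseˡ (proj₂ (E-finite X)) i

  infix 4 _≟_
  _≟_ : ∀ {X} → DecidableEquality (E X)
  _≟_ {X} = via-injection (↔⇒↣ (proj₂ (E-finite X))) Fin._≟_

  total : ∀ {X} → (E X → ℕ) → ℕ
  total {X} ν = sum (λ i → ν (enum X i))

  total-cong : ∀ {X} {μ ν : E X → ℕ} → μ ≗ ν → total μ ≡ total ν
  total-cong {X} μ≗ν = sum-cong-≗ (λ i → μ≗ν (enum X i))

  -- ν|_{Y=y}, without the requirement Y_*ν(y) ≠ 0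
  restrict : ∀ {X Y} → X ⇒ Y → E Y → (E X → ℕ) → (E X → ℕ)
  restrict π y ν x = if does (ℰ π x ≟ y) then ν x else 0

  restrict-cong : ∀ {X Y} (π : X ⇒ Y) y {μ ν} → μ ≗ ν →
                  restrict π y μ ≗ restrict π y ν
  restrict-cong π y μ≗ν x = cong (if does (ℰ π x ≟ y) then_else 0) (μ≗ν x)

  marginal : ∀ {X Y} → X ⇒ Y → (E X → ℕ) → (E Y → ℕ)
  marginal π ν y = total (restrict π y ν)

  sum-indicator : ∀ {n} (i : Fin n) m →
                  sum (λ j → if does (i Fin.≟ j) then m else 0) ≡ m
  sum-indicator {suc n} zero    m =
    trans (cong (m ℕ.+_) (sum-replicate-zero n)) (ℕ.+-identityʳ m)
  sum-indicator         (suc i) m = sum-indicator i m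

  total-marginal : ∀ {X Y} (π : X ⇒ Y) ν → total (marginal π ν) ≡ total ν
  total-marginal {X} {Y} π ν = begin
    sum (λ j → sum (λ i → restrict π (enum Y j) ν (enum X i)))
      ≡⟨ ∑-comm (λ j i → restrict π (enum Y j) ν (enum X i)) ⟩
    sum (λ i → sum (λ j → restrict π (enum Y j) ν (enum X i)))
      ≡⟨ sum-cong-≗ (λ i → fibre (enum X i)) ⟩
    sum (λ i → ν (enum X i)) ∎
    where
    fibre : ∀ x → sum (λ j → restrict π (enum Y j) ν x) ≡ ν x
    fibre x = begin
      sum (λ j → restrict π (enum Y j) ν x)
        ≡⟨ sum-cong-≗ (λ j → cong
             (λ k → if does (index Y (ℰ π x) Fin.≟ k) then ν x else 0)
             (index-enum Y j)) ⟩
      sum (λ j → if does (index Y (ℰ π x) Fin.≟ j) then ν x else 0)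
        ≡⟨ sum-indicator (index Y (ℰ π x)) (ν x) ⟩
      ν x ∎

  𝒞 : Ob → Set ℓe
  𝒞 X = Σ[ ν ∈ (E X → ℕ) ] 0 ℕ.< total ν

  𝒞-setoid : Ob → Setoid ℓe ℓe
  𝒞-setoid X = record
    { Carrier       = 𝒞 X
    ; _≈_           = _≗_ on proj₁
    ; isEquivalence = record
      { refl  = λ _ → refl
      ; sym   = λ p x → sym (p x)
      ; trans = λ p q x → trans (p x) (q x)
      }
    }

  ‖_‖ : ∀ {X} → 𝒞 X → ℕ
  ‖ ν , _ ‖ = total ν

  infix 8 _⁎_
  _⁎_ : ∀ {X Y} → X ⇒ Y → 𝒞 X → 𝒞 Y
  π ⁎ (ν , 0<ν) =
    marginal π ν , ℕ.<-≤-trans 0<ν (ℕ.≤-reflexive (sym (total-marginal π ν)))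

module Cohomology (ℝ : RealNumbers c ℓ₁ ℓ₂) (𝐒 : InformationStructure o ℓa ℓe) where
  open RealNumbers ℝ using (Carrier; ι) renaming (_*_ to _*ᵣ_)
  open PositiveReals ℝ using (ℝ₊; _≈₊_; exp; ℝ₊-abelianGroup)
  open InformationStructure 𝐒
  open Counting 𝐒
  private module ℝ₊ = AbelianGroup ℝ₊-abelianGroup
  open import Algebra.Properties.CommutativeMonoid.Sum ℝ₊.commutativeMonoid
    using () renaming (sum to product; sum-cong-≋ to product-cong)

  -- 𝒞 X is discrete, so every function on it is measurable; Func only
  -- adds compatibility with pointwise equality of counting functions.
  𝒢 : Ob → Set (ℓe ⊔ c ⊔ ℓ₁ ⊔ ℓ₂)
  𝒢 X = Func (𝒞-setoid X) ℝ₊.setoid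

  infixl 9 _⟨$⟩_
  _⟨$⟩_ : ∀ {X} → 𝒢 X → 𝒞 X → ℝ₊
  _⟨$⟩_ = Func.to

  ∏ : ∀ {Y} → (E Y → ℝ₊) → ℝ₊
  ∏ {Y} f = product (λ j → f (enum Y j))

  orOne : ∀ {X} → 𝒢 X → (μ : E X → ℕ) → Dec (0 ℕ.< total μ) → ℝ₊
  orOne g μ (yes 0<μ) = g ⟨$⟩ (μ , 0<μ)
  orOne g μ (no  _)   = ℝ₊.ε

  orOne-cong : ∀ {X} (g : 𝒢 X) {μ ν} p q → μ ≗ ν → orOne g μ p ≈₊ orOne g ν q
  orOne-cong g (yes p) (yes q) μ≗ν = Func.cong g μ≗ν
  orOne-cong {X} g (yes p) (no q) μ≗ν = contradiction
    (ℕ.<-≤-trans p (ℕ.≤-reflexive (total-cong {X} μ≗ν))) q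
  orOne-cong {X} g (no p) (yes q) μ≗ν = contradiction
    (ℕ.<-≤-trans q (ℕ.≤-reflexive (sym (total-cong {X} μ≗ν)))) p
  orOne-cong g (no p) (no q) μ≗ν = ℝ₊.refl {ℝ₊.ε}

  -- For π : X ⇒ Y, the factor of (Y . g)(ν) at y is g (ν|_{Y=y}) when
  -- Y_*ν(y) > 0, and 1 otherwise; recall that Y_*ν(y) is the total of
  -- ν|_{Y=y}.
  infixr 8 _▷_
  _▷_ : ∀ {X Y} → X ⇒ Y → 𝒢 X → 𝒢 X
  _▷_ {X} {Y} π g = record
    { to   = λ (ν , _) → ∏ (factor ν)
    ; cong = λ {μ} {ν} μ≗ν → product-cong λ j →
        orOne-cong g (0 ℕ.<? marginal π (proj₁ μ) (enum Y j))
                     (0 ℕ.<? marginal π (proj₁ ν) (enum Y j))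
                     (restrict-cong π (enum Y j) μ≗ν)
    }
    where
    factor : (E X → ℕ) → E Y → ℝ₊
    factor ν y = orOne g (restrict π y ν) (0 ℕ.<? marginal π ν y)

  record 0-Cochain : Set (o ⊔ ℓa ⊔ ℓe ⊔ c ⊔ ℓ₁ ⊔ ℓ₂) where
    field
      at      : ∀ X → 𝒢 X
      natural : ∀ {X Y} (π : X ⇒ Y) (ν : 𝒞 X) → at X ⟨$⟩ ν ≈₊ at Y ⟨$⟩ (π ⁎ ν)

  open 0-Cochain public

  -- δ ψ π is (δψ)_X[Y] for π : X ⇒ Y.
  δ : 0-Cochain → ∀ {X Y} → X ⇒ Y → 𝒢 X
  δ ψ {X} π = record
    { to   = λ ν → (π ▷ at ψ X) ⟨$⟩ ν ℝ₊.∙ (at ψ X ⟨$⟩ ν) ℝ₊.⁻¹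
    ; cong = λ {μ} {ν} μ≗ν → ℝ₊.∙-cong
        {(π ▷ at ψ X) ⟨$⟩ μ} {(π ▷ at ψ X) ⟨$⟩ ν}
        {(at ψ X ⟨$⟩ μ) ℝ₊.⁻¹} {(at ψ X ⟨$⟩ ν) ℝ₊.⁻¹}
        (Func.cong (π ▷ at ψ X) {μ} {ν} μ≗ν)
        (ℝ₊.⁻¹-cong {at ψ X ⟨$⟩ μ} {at ψ X ⟨$⟩ ν} 
          (Func.cong (at ψ X) {μ} {ν} μ≗ν))
    }

  H⁰ : Pred 0-Cochain (o ⊔ ℓa ⊔ ℓe ⊔ ℓ₁)
  H⁰ ψ = ∀ {X Y} (π : X ⇒ Y) (ν : 𝒞 X) → δ ψ π ⟨$⟩ ν ≈₊ ℝ₊.ε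

  -- The scalar multiple r . Exp for the action of ℝ by real powers:
  -- (r . Exp)_X(ν) = (exp ‖ν‖)^r = exp (r ‖ν‖).
  infix 8 _∙Exp
  _∙Exp : Carrier → 0-Cochain
  r ∙Exp = record
    { at = λ X → record
      { to   = λ ν → value ‖ ν ‖
      ; cong = λ {μ} {ν} μ≗ν → ≡⇒≈₊ (total-cong {X} μ≗ν)
      }
    ; natural = λ π ν → ≡⇒≈₊ (sym (total-marginal π (proj₁ ν)))
    }
    where
    value : ℕ → ℝ₊
    value n = exp (r *ᵣ ι n)
    ≡⇒≈₊ : ∀ {m n} → m ≡ n → value m ≈₊ value n
    ≡⇒≈₊ {m} refl = ℝ₊.refl {value m}

  ⟨Exp⟩ : Pred 0-Cochain (o ⊔ ℓe ⊔ c ⊔ ℓ₁)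
  ⟨Exp⟩ ψ = ∃ λ r → ∀ X ν → at ψ X ⟨$⟩ ν ≈₊ at (r ∙Exp) X ⟨$⟩ ν

{-# OPTIONS --safe #-}

-- By naturality a 0-cochain takes on a counting function of norm n a value φ(n)
-- that it already takes on E 𝟏.  An object with at least two outcomes turns the
-- cocycle equation into φ(m + n) = φ(m) φ(n), so φ(n) = φ(1)ⁿ = exp(n log φ(1)).
-- Conversely, exp(r ·) is multiplicative and marginals preserve the norm.  As ℝ is
-- given axiomatically, this needs exp(x + y) = exp(x) exp(y) and a logarithm.
module Submission where

open import Defs
open import Algebra.Bundles using (AbelianGroup; CommutativeMonoid; CommutativeRing)
open import Data.Bool.Base using (if_then_else_)
open import Data.Fin.Base using (Fin; zero; suc)
import Data.Fin.Properties as Fin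
open import Data.Nat.Base as ℕ using (ℕ; zero; suc)
import Data.Nat.Properties as ℕ
open import Algebra.Properties.CommutativeMonoid.Sum ℕ.+-0-commutativeMonoid
  using () renaming (sum to ∑; sum-cong-≗ to ∑-cong; sum-replicate-zero to ∑-replicate-zero)
open import Data.Product using (∃; _×_; _,_; proj₁; proj₂)
open import Data.Sum using (inj₁; inj₂)
open import Data.Vec.Functional using (Vector; _∷_; replicate)
open import Function.Base using (_∘_)
open import Function.Bundles using (_↔_; Injection; Inverse)
open import Function.Properties.Inverse using (↔⇒↣)
open import Level using (Level)
open import Relation.Binary.PropositionalEquality
  using (_≡_; _≢_; refl; sym; trans; cong)
open import Relation.Binary.Structures using (IsStrictPartialOrder)
open import Relation.Nullary using (¬_; does; yes; no; contradiction)
open import Relation.Nullary.Decidable using (dec-true)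
open import Relation.Unary using (_≐_; Pred; _∩_)

private variable
  c o ℓ₁ ℓ₂ ℓa ℓe ℓp ℓq : Level

-- Limits of real sequences and their arithmetic.

Eventually : Pred ℕ ℓp → Set ℓp
Eventually P = ∃ λ N → ∀ n → N ℕ.≤ n → P n

eventually-∩ : {P : Pred ℕ ℓp} {Q : Pred ℕ ℓq} →
               Eventually P → Eventually Q → Eventually (P ∩ Q)
eventually-∩ (M , P≥M) (N , Q≥N) = M ℕ.⊔ N , λ n M⊔N≤n →
  P≥M n (ℕ.≤-trans (ℕ.m≤m⊔n M N) M⊔N≤n) , Q≥N n (ℕ.≤-trans (ℕ.m≤n⊔m M N) M⊔N≤n)

eventually-map : {P : Pred ℕ ℓp} {Q : Pred ℕ ℓq} →
                 (∀ {n} → P n → Q n) → Eventually P → Eventually Q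
eventually-map f (N , P≥N) = N , λ n N≤n → f (P≥N n N≤n)

module Limits (ℝ : RealNumbers c ℓ₁ ℓ₂) where
  open RealNumbers ℝ
  open CommutativeRing commutativeRing using ()
    renaming (refl to ≈-refl; sym to ≈-sym; trans to ≈-trans)
  open IsStrictPartialOrder <-isStrictPartialOrder using ()
    renaming (<-respˡ-≈ to <-respˡ; <-respʳ-≈ to <-respʳ)
  open RealProperties ℝ
  open PositiveReals ℝ using (1/1+; 1/1+-inverse; 1/1+-pos; remainder-small)
  open ≤-Reasoning
  open import Algebra.Properties.AbelianGroup +-abelianGroup
    using (⁻¹-∙-comm; ⁻¹-involutive)
  open import Algebra.Properties.Ring ring using (-‿distribʳ-*)
  open import Algebra.Solver.Ring.NaturalCoefficients.Default
    commutativeSemiring using (solve; con; _:+_; _:*_; _:=_)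

  +-mono-< : ∀ {x y z w} → x < y → z < w → x + z < y + w
  +-mono-< {x} {y} {z} {w} x<y z<w = begin-strict
    x + z <⟨ +-monoˡ-< z x<y ⟩
    y + z <⟨ +-monoʳ-< y z<w ⟩
    y + w ∎

  -- Cotransitivity places `x + y` above `x + x` or below `y + y`; either comparison cancels one
  -- summand.
  double-cancel-< : ∀ {x y} → x + x < y + y → x < y
  double-cancel-< {x} {y} 2x<2y with <-cotransitive 2x<2y (x + y)
  ... | inj₁ x+x<x+y = +-cancelʳ-< x (<-respʳ (+-comm x y) x+x<x+y)
  ... | inj₂ x+y<y+y = +-cancelʳ-< y x+y<y+y

  <+⇒-< : ∀ {x y z} → x < z + y → x + - y < z
  <+⇒-< {x} {y} {z} p = <-respʳ (cancel+ z y) (+-monoˡ-< (- y) p)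

  neg-sub : ∀ x y → - (x + - y) ≈ y + - x
  neg-sub x y = begin-equality
    - (x + - y)   ≈⟨ ⁻¹-∙-comm x (- y) ⟨
    - x + - (- y) ≈⟨ +-congˡ (⁻¹-involutive y) ⟩
    - x + y       ≈⟨ +-comm (- x) y ⟩
    y + - x       ∎

  -- Encodes `|x| < ε` as two strict inequalities, without an absolute value.
  Within : Carrier → Pred Carrier ℓ₂
  Within ε x = x < ε × - x < ε

  within-cong : ∀ {ε δ x y} → ε ≈ δ → x ≈ y → Within ε x → Within δ y
  within-cong ε≈δ x≈y (x<ε , -x<ε) =
    <-respˡ x≈y (<-respʳ ε≈δ x<ε) , <-respˡ (-‿cong x≈y) (<-respʳ ε≈δ -x<ε)

  within-neg : ∀ {ε x} → Within ε x → Within ε (- x)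
  within-neg {x = x} (x<ε , -x<ε) = -x<ε , <-respˡ (≈-sym (⁻¹-involutive x)) x<ε

  within-+ : ∀ {ε δ x y} → Within ε x → Within δ y → Within (ε + δ) (x + y)
  within-+ {x = x} {y} (x<ε , -x<ε) (y<δ , -y<δ) =
    +-mono-< x<ε y<δ , <-respˡ (⁻¹-∙-comm x y) (+-mono-< -x<ε -y<δ)

  -- Twice `A * B - a * b` equals `(A - a)(B + b) + (A + a)(B - b)`, and all four factors are
  -- positive. This avoids any case split on signs.
  *-within-< : ∀ {A B a b} → Within A a → Within B b → a * b < A * B
  *-within-< {A} {B} {a} {b} (a<A , -a<A) (b<B , -b<B) = double-cancel-< (begin-strict
    a * b + a * b
      <⟨ x<x+y (<-respˡ (+-identityˡ 0#) (+-mono-<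
           (*-pos (<⇒0<- a<A) (reflect b<B -b<B)) (*-pos (reflect a<A -a<A) (<⇒0<- b<B)))) ⟩
    (a * b + a * b) + (p * (b + (b + q)) + (a + (a + p)) * q)
      ≈⟨ solve 4 (λ a b p q → (a :* b :+ a :* b) :+ (p :* (b :+ (b :+ q)) :+ (a :+ (a :+ p)) :* q)
           := (p :+ a) :* (q :+ b) :+ (p :+ a) :* (q :+ b)) ≈-refl a b p q ⟩
    (p + a) * (q + b) + (p + a) * (q + b)
      ≈⟨ +-cong (*-cong (cancel- A a) (cancel- B b)) (*-cong (cancel- A a) (cancel- B b)) ⟩
    A * B + A * B ∎)
    where
    p = A + - a
    q = B + - b
    -- `C + c` is written through `C + - c`, which the semiring solver can treat as an atom.
    reflect : ∀ {C c} → c < C → - c < C → 0# < c + (c + (C + - c))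
    reflect {C} {c} c<C -c<C = begin-strict
      0#                 ≈⟨ -‿inverseʳ c ⟨
      c + - c            <⟨ +-monoʳ-< c -c<C ⟩
      c + C              ≈⟨ +-congˡ (cancel- C c) ⟨
      c + ((C + - c) + c) ≈⟨ +-congˡ (+-comm (C + - c) c) ⟩
      c + (c + (C + - c)) ∎

  within-* : ∀ {A B a b} → Within A a → Within B b → Within (A * B) (a * b)
  within-* {a = a} {b} wa wb =
    *-within-< wa wb , <-respˡ (≈-sym (-‿distribʳ-* a b)) (*-within-< wa (within-neg wb))

  bounded : ∀ x → ∃ λ B → 0# < B × Within B x
  bounded x with M , x<M ← archimedean x | N , -x<N ← archimedean (- x) =
    -- The successor keeps the bound positive when `M` and `N` are both 0.
    ι (suc (M ℕ.⊔ N)) , ι-pos (M ℕ.⊔ N) ,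
    <-≤-trans x<M (ι-mono (ℕ.m≤n⇒m≤1+n (ℕ.m≤m⊔n M N))) ,
    <-≤-trans -x<N (ι-mono (ℕ.m≤n⇒m≤1+n (ℕ.m≤n⊔m M N)))

  Null : (ℕ → Carrier) → Set _
  Null d = ∀ ε → 0# < ε → Eventually (Within ε ∘ d)

  ⟶⇒null : ∀ {u l} → u ⟶ l → Null (λ n → u n + - l)
  ⟶⇒null {u} {l} u⟶l ε 0<ε = eventually-map
    (λ {n} (u<l+ε , l<u+ε) →
      <+⇒-< (<-respʳ (+-comm l ε) u<l+ε) ,
      <-respˡ (≈-sym (neg-sub (u n) l)) (<+⇒-< (<-respʳ (+-comm (u n) ε) l<u+ε)))
    (u⟶l ε 0<ε)

  -- With the error `d` as a parameter, each limit law reduces to an algebraic decomposition of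
  -- `u n` and the nullity of its error term.
  null⇒⟶ : ∀ {u l d} → (∀ n → u n ≈ d n + l) → Null d → u ⟶ l
  null⇒⟶ {u} {l} {d} u≈d+l d-null ε 0<ε = eventually-map
    (λ {n} (d<ε , -d<ε) →
      (begin-strict
        u n     ≈⟨ u≈d+l n ⟩
        d n + l <⟨ +-monoˡ-< l d<ε ⟩
        ε + l   ≈⟨ +-comm ε l ⟩
        l + ε   ∎) ,
      (begin-strict
        l                   ≈⟨ +-identityˡ l ⟨
        0# + l              ≈⟨ +-congʳ (-‿inverseʳ (d n)) ⟨
        (d n + - d n) + l   <⟨ +-monoˡ-< l (+-monoʳ-< (d n) -d<ε) ⟩
        (d n + ε) + l       ≈⟨ solve 3 (λ d ε l → (d :+ ε) :+ l := (d :+ l) :+ ε) ≈-refl (d n) ε l ⟩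
        (d n + l) + ε       ≈⟨ +-congʳ (u≈d+l n) ⟨
        u n + ε             ∎))
    (d-null ε 0<ε)

  null-0 : Null (λ _ → 0#)
  null-0 ε 0<ε = 0 , λ _ _ → 0<ε , <-respˡ 0≈-0 0<ε
    where
    0≈-0 : 0# ≈ - 0#
    0≈-0 = ≈-trans (≈-sym (-‿inverseʳ 0#)) (+-identityˡ (- 0#))

  null-+ : ∀ {d e} → Null d → Null e → Null (λ n → d n + e n)
  null-+ d-null e-null ε 0<ε = eventually-map
    (λ (wd , we) → within-cong halves ≈-refl (within-+ wd we))
    (eventually-∩ (d-null half 0<half) (e-null half 0<half))
    where
    half = ε * 1/1+ 1
    0<half : 0# < half
    0<half = *-pos 0<ε (1/1+-pos 1)
    halves : half + half ≈ ε
    halves = begin-equality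
      half + half        ≈⟨ solve 2 (λ ε i → ε :* i :+ ε :* i
                              := ε :* ((con 1 :+ (con 1 :+ con 0)) :* i)) ≈-refl ε (1/1+ 1) ⟩
      ε * (ι 2 * 1/1+ 1) ≈⟨ *-congˡ (1/1+-inverse 1) ⟩
      ε * 1#             ≈⟨ *-identityʳ ε ⟩
      ε                  ∎

  null-scale : ∀ x {d} → Null d → Null (λ n → x * d n)
  null-scale x d-null ε 0<ε with B , 0<B , wx ← bounded x with B⁻¹ , 0<B⁻¹ , BB⁻¹≈1 ← inverse 0<B =
    eventually-map (λ wd → within-cong eq ≈-refl (within-* wx wd))
      (d-null (ε * B⁻¹) (*-pos 0<ε 0<B⁻¹))
    where
    eq : B * (ε * B⁻¹) ≈ ε
    eq = begin-equality
      B * (ε * B⁻¹) ≈⟨ solve 3 (λ b e i → b :* (e :* i) := e :* (b :* i)) ≈-refl B ε B⁻¹ ⟩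
      ε * (B * B⁻¹) ≈⟨ *-congˡ BB⁻¹≈1 ⟩
      ε * 1#        ≈⟨ *-identityʳ ε ⟩
      ε             ∎

  -- Keeping one factor within 1 and the other within `ε` is enough.
  null-* : ∀ {d e} → Null d → Null e → Null (λ n → d n * e n)
  null-* d-null e-null ε 0<ε = eventually-map
    (λ (wd , we) → within-cong (*-identityˡ ε) ≈-refl (within-* wd we))
    (eventually-∩ (d-null 1# 0<1) (e-null ε 0<ε))

  lim-cong : ∀ {u v l m} → (∀ n → u n ≈ v n) → l ≈ m → u ⟶ l → v ⟶ m
  lim-cong u≈v l≈m u⟶l ε 0<ε = eventually-map
    (λ {n} (u<l+ε , l<u+ε) →
      <-respˡ (u≈v n) (<-respʳ (+-congʳ l≈m) u<l+ε) ,
      <-respˡ l≈m (<-respʳ (+-congʳ (u≈v n)) l<u+ε))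
    (u⟶l ε 0<ε)

  lim-const : ∀ x → (λ _ → x) ⟶ x
  lim-const x = null⇒⟶ (λ _ → ≈-sym (+-identityˡ x)) null-0

  lim-+ : ∀ {u v l m} → u ⟶ l → v ⟶ m → (λ n → u n + v n) ⟶ (l + m)
  lim-+ {u} {v} {l} {m} u⟶l v⟶m = null⇒⟶
    (λ n → begin-equality
      u n + v n ≈⟨ +-cong (cancel- (u n) l) (cancel- (v n) m) ⟨
      ((u n + - l) + l) + ((v n + - m) + m)
        ≈⟨ solve 4 (λ d e l m → (d :+ l) :+ (e :+ m) := (d :+ e) :+ (l :+ m)) ≈-refl _ _ l m ⟩
      ((u n + - l) + (v n + - m)) + (l + m) ∎)
    (null-+ (⟶⇒null u⟶l) (⟶⇒null v⟶m))

  lim-* : ∀ {u v l m} → u ⟶ l → v ⟶ m → (λ n → u n * v n) ⟶ (l * m)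
  lim-* {u} {v} {l} {m} u⟶l v⟶m = null⇒⟶
    (λ n → begin-equality
      u n * v n ≈⟨ *-cong (cancel- (u n) l) (cancel- (v n) m) ⟨
      ((u n + - l) + l) * ((v n + - m) + m)
        ≈⟨ solve 4 (λ d e l m → (d :+ l) :* (e :+ m) := ((l :* e :+ m :* d) :+ d :* e) :+ l :* m)
             ≈-refl _ _ l m ⟩
      ((l * (v n + - m) + m * (u n + - l)) + (u n + - l) * (v n + - m)) + l * m ∎)
    (null-+ (null-+ (null-scale l (⟶⇒null v⟶m)) (null-scale m (⟶⇒null u⟶l)))
            (null-* (⟶⇒null u⟶l) (⟶⇒null v⟶m)))

  lim-neg : ∀ {u l} → u ⟶ l → (λ n → - u n) ⟶ (- l)
  lim-neg {u} {l} u⟶l = null⇒⟶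
    (λ n → begin-equality
      - u n                 ≈⟨ cancel- (- u n) (- l) ⟨
      (- u n + - - l) + - l ≈⟨ +-congʳ (⁻¹-∙-comm (u n) (- l)) ⟩
      - (u n + - l) + - l   ∎)
    (λ ε 0<ε → eventually-map within-neg (⟶⇒null u⟶l ε 0<ε))

  -- Applies `limit-≥` with bound 0 to the differences `v n - u n`.
  lim-mono : ∀ {u v l m} → Eventually (λ n → u n ≤ v n) → u ⟶ l → v ⟶ m → l ≤ m
  lim-mono {u} {v} {l} {m} (N , u≤v) u⟶l v⟶m m<l = limit-≥ {λ n → v n + - u n}
    (λ n N≤n → ≤-trans (≈⇒≤ (≈-sym (-‿inverseʳ (u n)))) (+-monoˡ-≤ (- u n) (u≤v n N≤n)))
    (lim-+ v⟶m (lim-neg u⟶l))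
    (<-respʳ (-‿inverseʳ l) (+-monoˡ-< (- l) m<l))

  lim-unique : ∀ {u v l m} → (∀ n → u n ≈ v n) → u ⟶ l → v ⟶ m → l ≈ m
  lim-unique u≈v u⟶l v⟶m = <-antisym
    (lim-mono (0 , λ n _ → ≈⇒≤ (≈-sym (u≈v n))) v⟶m u⟶l)
    (lim-mono (0 , λ n _ → ≈⇒≤ (u≈v n)) u⟶l v⟶m)

  -- The case `x = 1` of `remainder-small`, hence the factors `1# * 1#`.
  1/1+⟶0 : 1/1+ ⟶ 0#
  1/1+⟶0 ε 0<ε with w , 0<w , εw≈1 ← inverse 0<ε
    with M , w<M ← archimedean ((1# * 1#) * w) = M , λ n M≤n →
      (begin-strict
        1/1+ n             ≈⟨ solve 1 (λ i → i := (con 1 :* con 1) :* i) ≈-refl (1/1+ n) ⟩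
        (1# * 1#) * 1/1+ n <⟨ remainder-small 1# 0<w εw≈1 w<M M≤n ⟩
        ε                  ≈⟨ +-identityˡ ε ⟨
        0# + ε             ∎) ,
      (begin-strict
        0#         ≈⟨ +-identityˡ 0# ⟨
        0# + 0#    <⟨ +-mono-< (1/1+-pos n) 0<ε ⟩
        1/1+ n + ε ∎)


-- The exponential turns sums into products.

module Exponential (ℝ : RealNumbers c ℓ₁ ℓ₂) where
  open RealNumbers ℝ
  open CommutativeRing commutativeRing using ()
    renaming (refl to ≈-refl; sym to ≈-sym; trans to ≈-trans)
  open RealProperties ℝ
  open PositiveReals ℝ
  open Limits ℝ
  open ≤-Reasoning
  open import Algebra.Properties.AbelianGroup +-abelianGroup
    using (⁻¹-∙-comm)
  open import Algebra.Properties.Semiring.Exp semiring using (^-congˡ)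
  open import Algebra.Properties.CommutativeSemiring.Exp commutativeSemiring
    using (^-distrib-*)
  open import Algebra.Solver.Ring.NaturalCoefficients.Default
    commutativeSemiring using (solve; con; _:+_; _:*_; _:=_)

  infix 9 e^_
  e^_ : Carrier → Carrier
  e^ x = proj₁ (exp x)

  e^-pos : ∀ x → 0# < e^ x
  e^-pos x = proj₂ (exp x)

  e^-nonneg : ∀ x → 0# ≤ e^ x
  e^-nonneg x = <⇒≤ (e^-pos x)

  -- `complete` chooses a limit for each sequence and is not assumed to respect pointwise equality,
  -- so uniqueness of limits is what identifies the two values.
  e^-cong : ∀ {x y} → x ≈ y → e^ x ≈ e^ y
  e^-cong {x} {y} x≈y = lim-unique
    (λ n → ^-congˡ (suc n) (+-congˡ (*-congʳ x≈y))) (exp-limit x) (exp-limit y)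

  eventually-large : ∀ x → Eventually (Large x)
  eventually-large x with N , p ← large x = N , λ n N≤n → large-mono N≤n p

  -- Bernoulli's inequality bounds `expSeq x n` below once `1 + x / n` is positive; the bound passes
  -- to the limit for `x` of any sign.
  1+x≤e^x : ∀ x → 1# + x ≤ e^ x
  1+x≤e^x x = lim-mono
    (eventually-map (λ {n} → bound n) (eventually-large x))
    (lim-const (1# + x)) (exp-limit x)
    where
    bound : ∀ n → Large x n → 1# + x ≤ expSeq x n
    bound n p = begin
      1# + x                              ≈⟨ +-congˡ (*-identityʳ x) ⟨
      1# + x * 1#                         ≈⟨ +-congˡ (*-congˡ (1/1+-inverse n)) ⟨
      1# + x * (ι (suc n) * 1/1+ n)
        ≈⟨ solve 3 (λ x n i → con 1 :+ x :* (n :* i) := con 1 :+ n :* (x :* i)) ≈-refl x (ι (suc n)) (1/1+ n) ⟩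
      1# + ι (suc n) * (x * 1/1+ n)       ≤⟨ bernoulli n (<⇒≤ (base-pos p)) ⟩
      expSeq x n ∎

  -- The three factors (1 + t/n) with t = x, y, z multiply to 1 + (A + B/n)/n²,
  -- whose n-th power is at least 1 + (A + B/n)/n.
  1≤e^-triple : ∀ {x y z} → (x + y) + z ≈ 0# → 1# ≤ (e^ x * e^ y) * e^ z
  1≤e^-triple {x} {y} {z} sum≈0 = lim-mono
    (eventually-map (λ {n} ((px , py) , pz) → bound n px py pz)
      (eventually-∩ (eventually-∩ (eventually-large x) (eventually-large y)) (eventually-large z)))
    (lim-cong (λ _ → ≈-refl) l≈1 lower-limit)
    (lim-* (lim-* (exp-limit x) (exp-limit y)) (exp-limit z))
    where
    -- `A` and `B` are the second and third elementary symmetric polynomials of `x`, `y`, `z`; the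
    -- first vanishes by `sum≈0`.
    A = x * y + (x + y) * z
    B = (x * y) * z
    lower-limit : (λ n → 1# + (A + B * 1/1+ n) * 1/1+ n) ⟶ (1# + (A + B * 0#) * 0#)
    lower-limit = lim-+ (lim-const 1#)
      (lim-* (lim-+ (lim-const A) (lim-* (lim-const B) 1/1+⟶0)) 1/1+⟶0)
    l≈1 : 1# + (A + B * 0#) * 0# ≈ 1#
    l≈1 = ≈-trans (+-congˡ (zeroʳ _)) (+-identityʳ 1#)
    bound : ∀ n → Large x n → Large y n → Large z n →
            1# + (A + B * 1/1+ n) * 1/1+ n ≤ (expSeq x n * expSeq y n) * expSeq z n
    bound n px py pz = begin
      1# + (A + B * i) * i             ≈⟨ +-congˡ (*-identityʳ _) ⟨
      1# + ((A + B * i) * i) * 1#      ≈⟨ +-congˡ (*-congˡ (1/1+-inverse n)) ⟨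
      1# + ((A + B * i) * i) * (k * i)
        ≈⟨ solve 3 (λ a i k → con 1 :+ (a :* i) :* (k :* i) := con 1 :+ k :* ((a :* i) :* i))
             ≈-refl (A + B * i) i k ⟩
      1# + k * d                       ≤⟨ bernoulli n (<⇒≤ (begin-strict
          0#              <⟨ *-pos (*-pos (base-pos px) (base-pos py)) (base-pos pz) ⟩
          (bx * by) * bz  ≈⟨ base-product ⟩
          1# + d          ∎)) ⟩
      (1# + d) ^ suc n                 ≈⟨ ^-congˡ (suc n) base-product ⟨
      ((bx * by) * bz) ^ suc n         ≈⟨ ^-distrib-* (bx * by) bz (suc n) ⟩
      (bx * by) ^ suc n * bz ^ suc n   ≈⟨ *-congʳ (^-distrib-* bx by (suc n)) ⟩
      (expSeq x n * expSeq y n) * expSeq z n ∎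
      where
      i = 1/1+ n
      k = ι (suc n)
      d = ((A + B * i) * i) * i
      bx = 1# + x * i
      by = 1# + y * i
      bz = 1# + z * i
      base-product : (bx * by) * bz ≈ 1# + d
      base-product = begin-equality
        (bx * by) * bz
          ≈⟨ solve 4 (λ x y z i →
               ((con 1 :+ x :* i) :* (con 1 :+ y :* i)) :* (con 1 :+ z :* i)
               := (con 1 :+ (((x :* y :+ (x :+ y) :* z) :+ ((x :* y) :* z) :* i) :* i) :* i)
                  :+ ((x :+ y) :+ z) :* i) ≈-refl x y z i ⟩
        (1# + d) + ((x + y) + z) * i ≈⟨ +-congˡ (*-congʳ sum≈0) ⟩
        (1# + d) + 0# * i            ≈⟨ +-congˡ (zeroˡ i) ⟩
        (1# + d) + 0#                ≈⟨ +-identityʳ _ ⟩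
        1# + d                       ∎

  -- The products of the approximants lie between `1 - x² / n` and 1 for large `n`, and the gap
  -- tends to 0.
  e^-neg : ∀ x → e^ x * e^ (- x) ≈ 1#
  e^-neg x = <-antisym
    (lim-mono
      (eventually-map (λ (p , q) → Opposite.1≤product+ p q) larges)
      (lim-const 1#)
      (lim-cong (λ _ → ≈-refl) l≈ (lim-+ product-limit (lim-* (lim-const (x * x)) 1/1+⟶0))))
    (lim-mono
      (eventually-map (λ (p , q) → Opposite.product≤1 p q) larges)
      product-limit (lim-const 1#))
    where
    larges = eventually-∩ (eventually-large x) (eventually-large (- x))
    product-limit : (λ n → expSeq x n * expSeq (- x) n) ⟶ (e^ x * e^ (- x))
    product-limit = lim-* (exp-limit x) (exp-limit (- x))
    l≈ : e^ x * e^ (- x) + (x * x) * 0# ≈ e^ x * e^ (- x)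
    l≈ = ≈-trans (+-congˡ (zeroʳ (x * x))) (+-identityʳ _)

  -- Multiply by `1≤e^-triple` for `- x`, `- y`, `x + y`, then cancel the opposite exponentials.
  e^-+-≥ : ∀ x y → e^ x * e^ y ≤ e^ (x + y)
  e^-+-≥ x y = begin
    e^ x * e^ y ≈⟨ *-identityʳ _ ⟨
    (e^ x * e^ y) * 1#
      ≤⟨ *-monoˡ-≤ (0≤* (e^-nonneg x) (e^-nonneg y)) (1≤e^-triple sum≈0) ⟩
    (e^ x * e^ y) * ((e^ (- x) * e^ (- y)) * e^ (x + y))
      ≈⟨ solve 5 (λ a b a′ b′ c → (a :* b) :* ((a′ :* b′) :* c) := ((a :* a′) :* (b :* b′)) :* c)
           ≈-refl (e^ x) (e^ y) (e^ (- x)) (e^ (- y)) (e^ (x + y)) ⟩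
    ((e^ x * e^ (- x)) * (e^ y * e^ (- y))) * e^ (x + y)
      ≈⟨ *-congʳ (*-cong (e^-neg x) (e^-neg y)) ⟩
    (1# * 1#) * e^ (x + y)
      ≈⟨ solve 1 (λ c → (con 1 :* con 1) :* c := c) ≈-refl (e^ (x + y)) ⟩
    e^ (x + y) ∎
    where
    sum≈0 : (- x + - y) + (x + y) ≈ 0#
    sum≈0 = ≈-trans (+-congʳ (⁻¹-∙-comm x y)) (-‿inverseˡ (x + y))

  -- The missing inequality is `e^-+-≥` for `x + y` and `- y`, multiplied by `e^ y`.
  e^-+ : ∀ x y → e^ (x + y) ≈ e^ x * e^ y
  e^-+ x y = <-antisym (e^-+-≥ x y) (begin
    e^ (x + y)                         ≈⟨ *-identityʳ _ ⟨
    e^ (x + y) * 1#                    ≈⟨ *-congˡ (e^-neg y) ⟨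
    e^ (x + y) * (e^ y * e^ (- y))
      ≈⟨ solve 3 (λ a b c → a :* (b :* c) := (a :* c) :* b) ≈-refl (e^ (x + y)) (e^ y) (e^ (- y)) ⟩
    (e^ (x + y) * e^ (- y)) * e^ y     ≤⟨ *-monoʳ-≤ (e^-nonneg y) (e^-+-≥ (x + y) (- y)) ⟩
    e^ ((x + y) + - y) * e^ y          ≈⟨ *-congʳ (e^-cong (cancel+ x y)) ⟩
    e^ x * e^ y                        ∎)

  e^0≈1 : e^ 0# ≈ 1#
  e^0≈1 = begin-equality
    e^ 0#              ≈⟨ e^-cong (-‿inverseʳ 0#) ⟨
    e^ (0# + - 0#)     ≈⟨ e^-+ 0# (- 0#) ⟩
    e^ 0# * e^ (- 0#)  ≈⟨ e^-neg 0# ⟩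
    1#                 ∎

-- Logarithms of positive reals.

-- Newton's method for e^x = a.  Writing v x = e^x / a, every iterate has v ≥ 1,
-- and each step at least halves v - 1.
module Logarithm (ℝ : RealNumbers c ℓ₁ ℓ₂) (a⁺ : PositiveReals.ℝ₊ ℝ) where
  open RealNumbers ℝ
  open CommutativeRing commutativeRing using ()
    renaming (refl to ≈-refl; sym to ≈-sym; trans to ≈-trans)
  open RealProperties ℝ
  open PositiveReals ℝ using (recip; recip-inverseʳ; 1/1+; 1/1+-inverse; 1/1+-pos)
  open Limits ℝ
  open Exponential ℝ
  open ≤-Reasoning
  open import Algebra.Solver.Ring.NaturalCoefficients.Default
    commutativeSemiring using (solve; con; _:+_; _:*_; _:=_)

  private
    a = proj₁ a⁺
    b = proj₁ (recip a⁺)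

    ab≈1 : a * b ≈ 1#
    ab≈1 = recip-inverseʳ a⁺

    v : Carrier → Carrier
    v x = b * e^ x

    v⁻¹ : Carrier → Carrier
    v⁻¹ x = a * e^ (- x)

    v-pos : ∀ x → 0# < v x
    v-pos x = *-pos (proj₂ (recip a⁺)) (e^-pos x)

    v*v⁻¹ : ∀ x → v x * v⁻¹ x ≈ 1#
    v*v⁻¹ x = begin-equality
      (b * e^ x) * (a * e^ (- x))
        ≈⟨ solve 4 (λ b e a e′ → (b :* e) :* (a :* e′) := (a :* b) :* (e :* e′))
             ≈-refl b (e^ x) a (e^ (- x)) ⟩
      (a * b) * (e^ x * e^ (- x)) ≈⟨ *-cong ab≈1 (e^-neg x) ⟩
      1# * 1#                     ≈⟨ *-identityˡ 1# ⟩
      1#                          ∎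

    v-+ : ∀ x h → v (x + h) ≈ v x * e^ h
    v-+ x h = ≈-trans (*-congˡ (e^-+ x h)) (≈-sym (*-assoc b (e^ x) (e^ h)))

    v-tangent : ∀ x h → v x * (1# + h) ≤ v (x + h)
    v-tangent x h = begin
      v x * (1# + h) ≤⟨ *-monoˡ-≤ (<⇒≤ (v-pos x)) (1+x≤e^x h) ⟩
      v x * e^ h     ≈⟨ v-+ x h ⟨
      v (x + h)      ∎

    v-tangent-at : ∀ x z → v x * (1# + (z + - x)) ≤ v z
    v-tangent-at x z = begin
      v x * (1# + (z + - x)) ≤⟨ v-tangent x (z + - x) ⟩
      v (x + (z + - x))      ≈⟨ *-congˡ (e^-cong (≈-trans (+-comm x _) (cancel- z x))) ⟩
      v z                    ∎

    -- The Newton step `x - (e^x - a) / e^x`, rewritten with `v⁻¹ x = a / e^x`.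
    newton : Carrier → Carrier
    newton x = x + (v⁻¹ x + - 1#)

    -- The tangent to `v` at `x` takes the value 1 at `newton x`, and `v` lies above its tangents.
    1≤v-newton : ∀ x → 1# ≤ v (newton x)
    1≤v-newton x = begin
      1#                             ≈⟨ v*v⁻¹ x ⟨
      v x * v⁻¹ x                    ≈⟨ *-congˡ (≈-trans (+-comm 1# _) (cancel- (v⁻¹ x) 1#)) ⟨
      v x * (1# + (v⁻¹ x + - 1#))    ≤⟨ v-tangent x (v⁻¹ x + - 1#) ⟩
      v (newton x)                   ∎

    w : Carrier → Carrier
    w x = v x + - 1#

    1+w≈v : ∀ x → 1# + w x ≈ v x
    1+w≈v x = ≈-trans (+-comm 1# (w x)) (cancel- (v x) 1#)

    0≤w : ∀ {x} → 1# ≤ v x → 0# ≤ w x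
    0≤w {x} 1≤v = begin
      0#         ≈⟨ -‿inverseʳ 1# ⟨
      1# + - 1#  ≤⟨ +-monoˡ-≤ (- 1#) 1≤v ⟩
      w x        ∎

    -- v (newton x) (2 - 1 / v x) ≤ v x, as 2 - 1 / v x ≤ e ^ (1 - 1 / v x);
    -- here multiplied by v x.
    newton-bound : ∀ x → v (newton x) * (1# + (w x + w x)) ≤ v x * v x
    newton-bound x = begin
      v′ * (1# + (w x + w x))    ≈⟨ *-congˡ (solve 1 (λ w → con 1 :+ (w :+ w) := w :+ (con 1 :+ w)) ≈-refl (w x)) ⟩
      v′ * (w x + (1# + w x))    ≈⟨ *-congˡ (+-congˡ (1+w≈v x)) ⟩
      v′ * (w x + v x)           ≈⟨ *-congˡ vs ⟨
      v′ * (v x * (1# + s))      ≈⟨ solve 3 (λ a b c → a :* (b :* c) := b :* (a :* c)) ≈-refl v′ (v x) (1# + s) ⟩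
      v x * (v′ * (1# + s))      ≤⟨ *-monoˡ-≤ (<⇒≤ (v-pos x)) (v-tangent (newton x) s) ⟩
      v x * v (newton x + s)     ≈⟨ *-congˡ (*-congˡ (e^-cong back)) ⟩
      v x * v x                  ∎
      where
      v′ = v (newton x)
      -- The displacement from `newton x` back to `x`: the tangent is now taken at `newton x`.
      s = 1# + - v⁻¹ x
      vs : v x * (1# + s) ≈ w x + v x
      vs = +-cancelʳ {z = 1#} (begin-equality
        v x * (1# + s) + 1#               ≈⟨ +-congˡ (v*v⁻¹ x) ⟨
        v x * (1# + s) + v x * v⁻¹ x      ≈⟨ solve 3 (λ v s y → v :* (con 1 :+ s) :+ v :* y := v :+ v :* (s :+ y)) ≈-refl (v x) s (v⁻¹ x) ⟩
        v x + v x * (s + v⁻¹ x)           ≈⟨ +-cong (≈-sym (cancel- (v x) 1#)) (*-congˡ (cancel- 1# (v⁻¹ x))) ⟩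
        (w x + 1#) + v x * 1#             ≈⟨ solve 2 (λ w v → (w :+ con 1) :+ v :* con 1 := (w :+ v) :+ con 1) ≈-refl (w x) (v x) ⟩
        (w x + v x) + 1#                  ∎)
      back : newton x + s ≈ x
      back = begin-equality
        (x + (v⁻¹ x + - 1#)) + (1# + - v⁻¹ x)
          ≈⟨ solve 5 (λ x y m o n → (x :+ (y :+ m)) :+ (o :+ n) := (x :+ (y :+ n)) :+ (m :+ o))
               ≈-refl x (v⁻¹ x) (- 1#) 1# (- v⁻¹ x) ⟩
        (x + (v⁻¹ x + - v⁻¹ x)) + (- 1# + 1#) ≈⟨ +-cong (+-congˡ (-‿inverseʳ _)) (-‿inverseˡ 1#) ⟩
        (x + 0#) + 0#                         ≈⟨ ≈-trans (+-identityʳ _) (+-identityʳ x) ⟩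
        x                                     ∎

    -- Write `w` and `w′` for the excess of `v` over 1 before and after the step. `newton-bound`
    -- reads `(1 + w′)(1 + 2w) ≤ (1 + w)²`, so `w′ (1 + 2w) ≤ w²`. Since `2w² ≤ w (1 + 2w)`, the
    -- positive factor `k = 1 + 2w` can be cancelled.
    w-halves : ∀ {x} → 1# ≤ v x → w (newton x) + w (newton x) ≤ w x
    w-halves {x} 1≤v w<2w′ = absurd (*-monoˡ-< 0<k w<2w′)
      where
      k = 1# + (w x + w x)
      w′ = w (newton x)
      0<k : 0# < k
      0<k = <-≤-trans 0<1 (x≤x+y (≤-trans (0≤w 1≤v) (x≤x+y (0≤w 1≤v))))
      w′k≤w² : w′ * k ≤ w x * w x
      w′k≤w² p = newton-bound x (begin-strict
        v x * v x                     ≈⟨ *-cong (1+w≈v x) (1+w≈v x) ⟨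
        (1# + w x) * (1# + w x)       ≈⟨ solve 1 (λ w → (con 1 :+ w) :* (con 1 :+ w) := (con 1 :+ (w :+ w)) :+ w :* w) ≈-refl (w x) ⟩
        k + w x * w x                 <⟨ +-monoʳ-< k p ⟩
        k + w′ * k                    ≈⟨ solve 2 (λ w k → k :+ w :* k := (con 1 :+ w) :* k) ≈-refl w′ k ⟩
        (1# + w′) * k                 ≈⟨ *-congʳ (1+w≈v (newton x)) ⟩
        v (newton x) * k              ∎)
      absurd : ¬ (k * w x < k * (w′ + w′))
      absurd = ≤-trans {y = w x * w x + w x * w x}
        (begin
          k * (w′ + w′)          ≈⟨ solve 2 (λ w k → k :* (w :+ w) := w :* k :+ w :* k) ≈-refl w′ k ⟩
          w′ * k + w′ * k        ≤⟨ +-monoˡ-≤ (w′ * k) w′k≤w² ⟩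
          w x * w x + w′ * k     ≤⟨ +-monoʳ-≤ (w x * w x) w′k≤w² ⟩
          w x * w x + w x * w x  ∎)
        (begin
          w x * w x + w x * w x          ≤⟨ x≤x+y (0≤w 1≤v) ⟩
          (w x * w x + w x * w x) + w x  ≈⟨ solve 1 (λ w → (w :* w :+ w :* w) :+ w := (con 1 :+ (w :+ w)) :* w) ≈-refl (w x) ⟩
          k * w x                        ∎)

    iterate : ℕ → Carrier
    iterate zero    = newton 0#
    iterate (suc n) = newton (iterate n)

    1≤v-iterate : ∀ n → 1# ≤ v (iterate n)
    1≤v-iterate zero    = 1≤v-newton 0#
    1≤v-iterate (suc n) = 1≤v-newton (iterate n)

    w₀ = w (iterate 0)

    -- Weakens geometric decay to the rate `1 / (n + 1)`, for which a null sequence is at hand. The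
    -- induction step rests on `n + 2 ≤ 2 (n + 1)`.
    ιw≤w₀ : ∀ n → ι (suc n) * w (iterate n) ≤ w₀
    ιw≤w₀ zero    = ≈⇒≤ (solve 1 (λ w → (con 1 :+ con 0) :* w := w) ≈-refl w₀)
    ιw≤w₀ (suc n) = begin
      (1# + (1# + ι n)) * w′         ≤⟨ x≤x+y (0≤* (ι-nonneg n) (0≤w (1≤v-iterate (suc n)))) ⟩
      (1# + (1# + ι n)) * w′ + ι n * w′
        ≈⟨ solve 2 (λ k w → (con 1 :+ (con 1 :+ k)) :* w :+ k :* w := (con 1 :+ k) :* (w :+ w)) ≈-refl (ι n) w′ ⟩
      ι (suc n) * (w′ + w′)          ≤⟨ *-monoˡ-≤ (ι-nonneg (suc n)) (w-halves (1≤v-iterate n)) ⟩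
      ι (suc n) * w (iterate n)      ≤⟨ ιw≤w₀ n ⟩
      w₀                             ∎
      where w′ = w (iterate (suc n))

    w≤w₀/n : ∀ n → w (iterate n) ≤ w₀ * 1/1+ n
    w≤w₀/n n = begin
      wₙ                            ≈⟨ *-identityʳ wₙ ⟨
      wₙ * 1#                       ≈⟨ *-congˡ (1/1+-inverse n) ⟨
      wₙ * (ι (suc n) * 1/1+ n)     ≈⟨ solve 3 (λ w k i → w :* (k :* i) := (k :* w) :* i) ≈-refl wₙ (ι (suc n)) (1/1+ n) ⟩
      (ι (suc n) * wₙ) * 1/1+ n     ≤⟨ *-monoʳ-≤ (<⇒≤ (1/1+-pos n)) (ιw≤w₀ n) ⟩
      w₀ * 1/1+ n                   ∎
      where wₙ = w (iterate n)

    w₀/n⟶0 : (λ n → w₀ * 1/1+ n) ⟶ (w₀ * 0#)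
    w₀/n⟶0 = lim-* (lim-const w₀) 1/1+⟶0

    w⟶0 : (λ n → w (iterate n)) ⟶ 0#
    w⟶0 ε 0<ε = eventually-map
      (λ {n} (u<l+ε , _) →
        (begin-strict
          w (iterate n) ≤⟨ w≤w₀/n n ⟩
          w₀ * 1/1+ n   <⟨ u<l+ε ⟩
          w₀ * 0# + ε   ≈⟨ +-congʳ (zeroʳ w₀) ⟩
          0# + ε        ∎) ,
        (begin-strict
          0#                ≤⟨ 0≤w (1≤v-iterate n) ⟩
          w (iterate n)     <⟨ x<x+y 0<ε ⟩
          w (iterate n) + ε ∎))
      (w₀/n⟶0 ε 0<ε)

    v⟶1 : (λ n → v (iterate n)) ⟶ 1#
    v⟶1 = lim-cong (λ n → cancel- (v (iterate n)) 1#) (+-identityˡ 1#)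
      (lim-+ w⟶0 (lim-const 1#))

    -- Turns the convergence of `w` to 0 along the iterates into the Cauchy property of the iterates
    -- themselves.
    difference-≤w : ∀ x {z} → 1# ≤ v z → x ≤ z + w x
    difference-≤w x {z} 1≤v = begin
      x                                 ≈⟨ cancel- x z ⟨
      (x + - z) + z                     ≈⟨ +-comm _ z ⟩
      z + (x + - z)                     ≤⟨ +-monoʳ-≤ z bound ⟩
      z + w x                           ∎
      where
      h = x + - z
      -- 1 + h ≤ e^h = v x / v z
      bound : h ≤ w x
      bound = begin
        h                     ≈⟨ cancel+ h 1# ⟨
        (h + 1#) + - 1#       ≤⟨ +-monoˡ-≤ (- 1#) (begin
          h + 1#        ≈⟨ +-comm h 1# ⟩
          1# + h        ≤⟨ 1+x≤e^x h ⟩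
          e^ h          ≈⟨ *-identityˡ _ ⟨
          1# * e^ h     ≤⟨ *-monoʳ-≤ (e^-nonneg h) 1≤v ⟩
          v z * e^ h    ≈⟨ v-+ z h ⟨
          v (z + h)     ≈⟨ *-congˡ (e^-cong (≈-trans (+-comm z h) (cancel- x z))) ⟩
          v x           ∎) ⟩
        w x                   ∎

    iterate-cauchy : IsCauchy iterate
    -- `IsCauchy` asks for one inequality per ordered pair of indices, so smallness of `w` at the
    -- first index gives it.
    iterate-cauchy ε 0<ε = proj₁ small , λ m n N≤m _ → begin-strict
      iterate m                   ≤⟨ difference-≤w (iterate m) (1≤v-iterate n) ⟩
      iterate n + w (iterate m)   <⟨ +-monoʳ-< (iterate n) (proj₁ (proj₂ small m N≤m)) ⟩
      iterate n + (0# + ε)        ≈⟨ +-congˡ (+-identityˡ ε) ⟩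
      iterate n + ε               ∎
      where small = w⟶0 ε 0<ε

  log : Carrier
  log = proj₁ (complete iterate iterate-cauchy)

  private
    iterate⟶log : iterate ⟶ log
    iterate⟶log = proj₂ (complete iterate iterate-cauchy)

    -- Tangents take the place of continuity of `v`. The tangent at `iterate n`, evaluated at `log`,
    -- gives `1 ≤ v log` in the limit; the tangent at `log`, evaluated at `iterate n`, gives
    -- `v log ≤ 1`.
    v-log≈1 : v log ≈ 1#
    v-log≈1 = <-antisym
      (begin
        1#                              ≈⟨ solve 0 (con 1 := con 1 :* (con 1 :+ con 0)) ≈-refl ⟩
        1# * (1# + 0#)                  ≈⟨ *-congˡ (+-congˡ (-‿inverseʳ log)) ⟨
        1# * (1# + (log + - log))
          ≤⟨ lim-mono (0 , λ n _ → v-tangent-at (iterate n) log)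
               (lim-* v⟶1 (lim-+ (lim-const 1#) (lim-+ (lim-const log) (lim-neg iterate⟶log))))
               (lim-const (v log)) ⟩
        v log                           ∎)
      (begin
        v log                           ≈⟨ solve 1 (λ v → v := v :* (con 1 :+ con 0)) ≈-refl (v log) ⟩
        v log * (1# + 0#)               ≈⟨ *-congˡ (+-congˡ (-‿inverseʳ log)) ⟨
        v log * (1# + (log + - log))
          ≤⟨ lim-mono (0 , λ n _ → v-tangent-at log (iterate n))
               (lim-* (lim-const (v log)) (lim-+ (lim-const 1#) (lim-+ iterate⟶log (lim-const (- log)))))
               v⟶1 ⟩
        1#                              ∎)

  e^-log : e^ log ≈ a
  e^-log = begin-equality
    e^ log             ≈⟨ *-identityˡ _ ⟨
    1# * e^ log        ≈⟨ *-congʳ ab≈1 ⟨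
    (a * b) * e^ log   ≈⟨ *-assoc a b (e^ log) ⟩
    a * v log          ≈⟨ *-congˡ v-log≈1 ⟩
    a * 1#             ≈⟨ *-identityʳ a ⟩
    a                  ∎

-- Homomorphisms from the natural numbers and finite sums.

module NatSums (M : CommutativeMonoid c ℓ₁) where
  open CommutativeMonoid M renaming (sym to ≈-sym; trans to ≈-trans) hiding (refl)
  open import Algebra.Properties.CommutativeMonoid.Sum M
    using (sum-cong-≋; sum-replicate-zero) renaming (sum to ∑ᴹ)
  open import Relation.Binary.Reasoning.Setoid setoid

  module _ (h : ℕ → Carrier) (h-0 : h 0 ≈ ε) where

    ∑-homomorphic : (∀ m n → h (m ℕ.+ n) ≈ h m ∙ h n) →
                    ∀ {k} (t : Vector ℕ k) → ∑ᴹ (h ∘ t) ≈ h (∑ t)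
    ∑-homomorphic h-+ {zero}  t = ≈-sym h-0
    ∑-homomorphic h-+ {suc k} t =
      ≈-trans (∙-congˡ (∑-homomorphic h-+ (t ∘ suc))) (≈-sym (h-+ (t zero) (∑ (t ∘ suc))))

    -- Only the vectors (1, n, 0, …, 0) matter.
    suc-homomorphic : ∀ {k} → 2 ℕ.≤ k →
      (∀ (t : Vector ℕ k) → 0 ℕ.< ∑ t → ∑ᴹ (h ∘ t) ≈ h (∑ t)) →
      ∀ n → h (suc n) ≈ h 1 ∙ h n
    suc-homomorphic {suc (suc k)} (ℕ.s≤s (ℕ.s≤s _)) h-∑ n = begin
      h (suc n)                              ≡⟨ cong (h ∘ suc) (ℕ.+-identityʳ n) ⟨
      h (suc (n ℕ.+ 0))                      ≡⟨ cong (λ z → h (suc (n ℕ.+ z))) (∑-replicate-zero k) ⟨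
      -- The leading 1 makes the sum positive even for `n = 0`, so `h-∑` applies.
      h (∑ t)                                ≈⟨ h-∑ t (ℕ.s≤s ℕ.z≤n) ⟨
      h 1 ∙ (h n ∙ ∑ᴹ (h ∘ replicate k 0))   ≈⟨ ∙-congˡ (∙-congˡ (≈-trans (sum-cong-≋ {k} (λ _ → h-0)) (sum-replicate-zero k))) ⟩
      h 1 ∙ (h n ∙ ε)                        ≈⟨ ∙-congˡ (identityʳ (h n)) ⟩
      h 1 ∙ h n                              ∎
      where t = 1 ∷ n ∷ replicate k 0

-- Outcome sets, and marginals along terminal and identity arrows.

∑-pick : ∀ {k} (t : Vector ℕ k) j → ∑ (λ i → if does (i Fin.≟ j) then t i else 0) ≡ t j
∑-pick {suc k} t zero    = trans (cong (t zero ℕ.+_) (∑-replicate-zero k)) (ℕ.+-identityʳ (t zero))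
∑-pick         t (suc j) = ∑-pick (t ∘ suc) j

module Outcomes (𝐒 : InformationStructure o ℓa ℓe) where
  open InformationStructure 𝐒
  open Counting 𝐒

  E𝟏-unique : (x y : E 𝟏) → x ≡ y
  E𝟏-unique x y = Injection.injective (↔⇒↣ E𝟏-singleton) refl

  -- `E X` is nonempty because it surjects onto the singleton `E 𝟏`. With exactly one outcome this
  -- surjection would be bijective, against `ℰ-conservative`.
  two-outcomes : ∀ {X} → X ≢ 𝟏 → 2 ℕ.≤ ∣E X ∣
  two-outcomes {X} X≢𝟏 = at-least-two (proj₂ (E-finite X))
    where
    π = 𝟏-terminal X
    x₀ : E X
    x₀ = proj₁ (ℰ-surjective π (Inverse.from E𝟏-singleton _))
    at-least-two : ∀ {k} → E X ↔ Fin k → 2 ℕ.≤ k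
    at-least-two {0} e with () ← Inverse.to e x₀
    at-least-two {1} e = contradiction
      ((λ {x} {y} _ → Injection.injective (↔⇒↣ e) (Fin1-unique (Inverse.to e x) (Inverse.to e y)))
      , ℰ-surjective π)
      (ℰ-conservative π X≢𝟏)
      where
      Fin1-unique : (i j : Fin 1) → i ≡ j
      Fin1-unique zero zero = refl
    at-least-two {suc (suc k)} e = ℕ.s≤s (ℕ.s≤s ℕ.z≤n)

  marginal-𝟏 : ∀ {X} (π : X ⇒ 𝟏) ν y → marginal π ν y ≡ total {X} ν
  marginal-𝟏 {X} π ν y = total-cong {X} (λ x →
    cong (if_then ν x else 0) (dec-true (ℰ π x ≟ y) (E𝟏-unique (ℰ π x) y)))

  -- Makes every vector `t` the list of factor norms in the cocycle equation of an identity arrow.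
  marginal-id : ∀ {X} (t : Vector ℕ ∣E X ∣) j →
                marginal (idA {X}) (t ∘ index X) (enum X j) ≡ t j
  marginal-id {X} t j = trans (∑-cong pointwise) (∑-pick t j)
    where
    pointwise : ∀ i → restrict (idA {X}) (enum X j) (t ∘ index X) (enum X i) ≡
                      (if does (i Fin.≟ j) then t i else 0)
    pointwise i = cong₃ (λ i′ i″ j′ → if does (i′ Fin.≟ j′) then t i″ else 0)
      (trans (cong (index X) (ℰ-id (enum X i))) (index-enum X i))
      (index-enum X i) (index-enum X j)
      where
      cong₃ : (f : Fin ∣E X ∣ → Fin ∣E X ∣ → Fin ∣E X ∣ → ℕ) →
              ∀ {x x′ y y′ z z′} → x ≡ x′ → y ≡ y′ → z ≡ z′ → f x y z ≡ f x′ y′ z′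
      cong₃ f refl refl refl = refl

-- Cocycles compared with real multiples of `Exp`.

module ZerothCohomology (ℝ : RealNumbers c ℓ₁ ℓ₂) (𝐒 : InformationStructure o ℓa ℓe) where
  open RealNumbers ℝ using
    (Carrier; _≈_; ι; 1#; _+_; _*_; *-cong; *-congˡ; *-congʳ; *-identityʳ; zeroʳ; distribˡ; commutativeRing)
  open import Algebra.Properties.Semiring.Mult (RealNumbers.semiring ℝ) using (×-homo-+)
  open CommutativeRing commutativeRing using () renaming (sym to ≈-sym; trans to ≈-trans)
  open PositiveReals ℝ using (ℝ₊; _≈₊_; exp; 1₊; _·_; ℝ₊-abelianGroup)
  open RealProperties.≤-Reasoning ℝ
  open Exponential ℝ
  open InformationStructure 𝐒
  open Counting 𝐒
  open Outcomes 𝐒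
  open Cohomology ℝ 𝐒
  private module ℝ₊ = AbelianGroup ℝ₊-abelianGroup
  open import Algebra.Properties.Group ℝ₊.group using (x∙y⁻¹≈ε⇒x≈y; x≈y⇒x∙y⁻¹≈ε)
  open import Algebra.Properties.CommutativeMonoid.Sum ℝ₊.commutativeMonoid
    using () renaming (sum to product; sum-cong-≋ to product-cong)
  open NatSums ℝ₊.commutativeMonoid

  module _ (ψ : 0-Cochain) where

    -- The value of ψ on any counting function of norm n > 0, extended by 1 at n = 0.
    profile : ℕ → ℝ₊
    profile n = orOne (at ψ 𝟏) (λ _ → n) (0 ℕ.<? total {𝟏} (λ _ → n))

    private
      zero-not-positive : ¬ (0 ℕ.< total {𝟏} (λ _ → 0))
      zero-not-positive 0<0 =
        ℕ.<-irrefl (sym (∑-replicate-zero ∣E 𝟏 ∣)) 0<0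

    profile-0 : profile 0 ≈₊ 1₊
    profile-0 = orOne-cong (at ψ 𝟏) (0 ℕ.<? total {𝟏} (λ _ → 0)) (no zero-not-positive) (λ _ → refl)

    -- For positive norm this is naturality along the arrow to `𝟏`; for norm 0 both sides are 1.
    -- Covering both cases treats empty and nonempty fibres of `▷` alike.
    orOne≈profile : ∀ {X} (μ : E X → ℕ) d → orOne (at ψ X) μ d ≈₊ profile (total {X} μ)
    orOne≈profile {X} μ (yes 0<μ) = ≈-trans (natural ψ π (μ , 0<μ))
      (orOne-cong (at ψ 𝟏) (yes (proj₂ (π ⁎ (μ , 0<μ)))) (0 ℕ.<? total {𝟏} (λ _ → total {X} μ))
        (marginal-𝟏 π μ))
      where π = 𝟏-terminal X
    orOne≈profile {X} μ (no 0≮μ) =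
      orOne-cong (at ψ 𝟏) (no zero-not-positive) (0 ℕ.<? total {𝟏} (λ _ → total {X} μ))
        (λ _ → sym (ℕ.n≤0⇒n≡0 (ℕ.≮⇒≥ 0≮μ)))

    at≈profile : ∀ X (ν : 𝒞 X) → at ψ X ⟨$⟩ ν ≈₊ profile ‖ ν ‖
    at≈profile X (ν , 0<ν) = orOne≈profile ν (yes 0<ν)

    ▷≈product : ∀ {X Y} (π : X ⇒ Y) (ν : 𝒞 X) →
      (π ▷ at ψ X) ⟨$⟩ ν ≈₊ product (λ j → profile (marginal π (proj₁ ν) (enum Y j)))
    ▷≈product {X} {Y} π (ν , _) = product-cong λ j →
      orOne≈profile (restrict π (enum Y j) ν) (0 ℕ.<? marginal π ν (enum Y j))

    -- The identity arrow of `X` splits a counting function into its single outcomes, so the cocycle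
    -- equation makes `profile` turn sums over `E X` into products. Two outcomes then suffice to
    -- separate 1 from `n`.
    profile-suc : H⁰ ψ → ∀ {X} → X ≢ 𝟏 → ∀ n → profile (suc n) ≈₊ profile 1 · profile n
    profile-suc cocycle {X} X≢𝟏 = suc-homomorphic profile profile-0 (two-outcomes X≢𝟏) cocycle-id
      where
      cocycle-id : ∀ (t : Vector ℕ ∣E X ∣) → 0 ℕ.< ∑ t →
                   product (profile ∘ t) ≈₊ profile (∑ t)
      cocycle-id t 0<t = begin-equality
        proj₁ (product (profile ∘ t))
          ≈⟨ product-cong (λ j → ≡⇒≈ (marginal-id t j)) ⟨
        proj₁ (product (λ j → profile (marginal (idA {X}) (proj₁ ν) (enum X j))))
          ≈⟨ ▷≈product (idA {X}) ν ⟨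
        proj₁ ((idA ▷ at ψ X) ⟨$⟩ ν)
          ≈⟨ x∙y⁻¹≈ε⇒x≈y ((idA ▷ at ψ X) ⟨$⟩ ν) (at ψ X ⟨$⟩ ν) (cocycle idA ν) ⟩
        proj₁ (at ψ X ⟨$⟩ ν)
          ≈⟨ at≈profile X ν ⟩
        proj₁ (profile ‖ ν ‖)
          ≡⟨ cong (proj₁ ∘ profile) total-t ⟩
        proj₁ (profile (∑ t)) ∎
        where
        total-t : total {X} (t ∘ index X) ≡ ∑ t
        total-t = ∑-cong (λ i → cong t (index-enum X i))
        ν : 𝒞 X
        ν = t ∘ index X , ℕ.<-≤-trans 0<t (ℕ.≤-reflexive (sym total-t))
        ≡⇒≈ : ∀ {m n} → m ≡ n → profile m ≈₊ profile n
        ≡⇒≈ {m} refl = ℝ₊.refl {profile m}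

  module _ (r : Carrier) where

    exp-0 : exp (r * ι 0) ≈₊ 1₊
    exp-0 = ≈-trans (e^-cong (zeroʳ r)) e^0≈1

    exp-+ : ∀ m n → exp (r * ι (m ℕ.+ n)) ≈₊ exp (r * ι m) · exp (r * ι n)
    exp-+ m n = begin-equality
      e^ (r * ι (m ℕ.+ n))        ≈⟨ e^-cong (*-congˡ (×-homo-+ 1# m n)) ⟩
      e^ (r * (ι m + ι n))        ≈⟨ e^-cong (distribˡ r (ι m) (ι n)) ⟩
      e^ (r * ι m + r * ι n)      ≈⟨ e^-+ (r * ι m) (r * ι n) ⟩
      e^ (r * ι m) * e^ (r * ι n) ∎

    exp-profile : ∀ (h : ℕ → ℝ₊) → h 0 ≈₊ 1₊ → (∀ n → h (suc n) ≈₊ h 1 · h n) →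
                  exp r ≈₊ h 1 → ∀ n → h n ≈₊ exp (r * ι n)
    exp-profile h h-0 h-suc e^r≈h1 zero    = ≈-trans h-0 (≈-sym exp-0)
    exp-profile h h-0 h-suc e^r≈h1 (suc n) = begin-equality
      proj₁ (h (suc n))             ≈⟨ h-suc n ⟩
      proj₁ (h 1) * proj₁ (h n)     ≈⟨ *-cong (≈-sym e^r≈h1) (exp-profile h h-0 h-suc e^r≈h1 n) ⟩
      e^ r * e^ (r * ι n)           ≈⟨ *-congʳ (e^-cong r*ι1≈r) ⟨
      e^ (r * ι 1) * e^ (r * ι n)   ≈⟨ exp-+ 1 n ⟨
      e^ (r * ι (suc n))            ∎
      where
      r*ι1≈r : r * ι 1 ≈ r
      r*ι1≈r = ≈-trans (*-congˡ (RealNumbers.+-identityʳ ℝ 1#)) (*-identityʳ r)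

  H⁰⊆⟨Exp⟩ : Nontrivial → ∀ {ψ} → H⁰ ψ → ⟨Exp⟩ ψ
  -- The scalar is the logarithm of the value of `ψ` at norm 1.
  H⁰⊆⟨Exp⟩ (X , X≢𝟏) {ψ} cocycle = log , λ Y ν → ≈-trans (at≈profile ψ Y ν)
    (exp-profile log (profile ψ) (profile-0 ψ) (profile-suc ψ cocycle X≢𝟏) e^-log ‖ ν ‖)
    where open Logarithm ℝ (profile ψ 1)

  -- The product over the fibres is the exponential of `r` times the sum of the marginals, which is
  -- the norm of `ν`.
  ⟨Exp⟩⊆H⁰ : ∀ {ψ} → ⟨Exp⟩ ψ → H⁰ ψ
  ⟨Exp⟩⊆H⁰ {ψ} (r , ψ≈r∙Exp) {X} {Y} π ν =
    x≈y⇒x∙y⁻¹≈ε {(π ▷ at ψ X) ⟨$⟩ ν} {at ψ X ⟨$⟩ ν} (begin-equality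
      proj₁ ((π ▷ at ψ X) ⟨$⟩ ν)
        ≈⟨ product-cong (λ j → factor (restrict π (enum Y j) (proj₁ ν)) (0 ℕ.<? marginal π (proj₁ ν) (enum Y j))) ⟩
      proj₁ (product (λ j → exp (r * ι (marginal π (proj₁ ν) (enum Y j)))))
        ≈⟨ ∑-homomorphic (λ n → exp (r * ι n)) (exp-0 r) (exp-+ r) (λ j → marginal π (proj₁ ν) (enum Y j)) ⟩
      e^ (r * ι (total {Y} (marginal π (proj₁ ν))))
        ≡⟨ cong (λ n → e^ (r * ι n)) (total-marginal π (proj₁ ν)) ⟩
      e^ (r * ι ‖ ν ‖)
        ≈⟨ ψ≈r∙Exp X ν ⟨
      proj₁ (at ψ X ⟨$⟩ ν) ∎)
    where
    -- The default factor 1 at an empty fibre agrees with `exp` at 0.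
    factor : ∀ μ d → orOne (at ψ X) μ d ≈₊ exp (r * ι (total {X} μ))
    factor μ (yes 0<μ) = ψ≈r∙Exp X (μ , 0<μ)
    factor μ (no  0≮μ) = ≈-sym (≈-trans
      (e^-cong (*-congˡ (RealNumbers.reflexive ℝ (cong ι (ℕ.n≤0⇒n≡0 (ℕ.≮⇒≥ 0≮μ))))))
      (exp-0 r))

proposition4 : ∀ {c ℓ₁ ℓ₂ o ℓa ℓe} (ℝ : RealNumbers c ℓ₁ ℓ₂) (𝐒 : InformationStructure o ℓa ℓe) →
    InformationStructure.Nontrivial 𝐒 →
    Cohomology.H⁰ ℝ 𝐒 ≐ Cohomology.⟨Exp⟩ ℝ 𝐒
proposition4 ℝ 𝐒 nontrivial = (λ {ψ} → H⁰⊆⟨Exp⟩ nontrivial {ψ}) , (λ {ψ} → ⟨Exp⟩⊆H⁰ {ψ})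
  where open ZerothCohomology ℝ 𝐒
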